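{- Let $B$ be a finite set of Boolean functions. Then $\mathrm{MC}(\{\mathbf{S}\},B)$ is solvable in deterministic logarithmic space.
   Context: For a finite set $B$ of Boolean functions, temporal $B$-formulae over $\{\mathbf{S}\}$ are built from propositional variables by applying functions from $B$ and the binary operator $\mathbf{S}$. A Kripke structure is $K=(W,R,\eta)$ with $W$ finite, $R\subseteq W\times W$ total, $\eta:W\to2^{\mathrm{VAR}}$; a path is an infinite sequence $p=(p_0,p_1,\dots)$ with $p_iRp_{i+1}$. Satisfaction: $p,i\vDash x$ iff $x\in\eta(p_i)$; $p,i\vDash f(\varphi_1,\dots,\varphi_n)$ iff $f$ of the truth values at $i$ is $1$; $p,i\vDash\varphi_1\mathbf{S}\varphi_2$ iff there is $\ell$ with $0\le\ell\le i$, $p,\ell\vDash\varphi_2$ and $p,j\vDash\varphi_1$ for all $\ell<j\le i$. $\mathrm{MC}(\{\mathbf{S}\},B)$: given such a formula $\varphi$, a Kripke structure $K$ and a state $a$, decide whether some path $p$ with $p_0=a$ has $p,0\vDash\varphi$. -}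

module Defs where

open import Data.Nat using (ℕ; zero; suc; _+_; _*_; _≤_; _<_; _⊓_; _≟_)
open import Relation.Nullary using (yes; no)
open import Data.Nat.Logarithm using (⌊log₂_⌋)
import Data.Nat.Binary.Base as Bin
open import Data.Nat.Binary.Base using (ℕᵇ; 2[1+_]; 1+[2_])
open import Data.Bool using (Bool; true; false; if_then_else_)
open import Data.Fin using (Fin; toℕ)
open import Data.List using (List; []; _∷_; _++_; length; concat; map; lookup)
open import Data.List.Membership.Propositional using (_∈_)
open import Data.Vec using (Vec; []; _∷_; allFin)
import Data.Vec as V
open import Data.Maybe using (Maybe; just; nothing)
open import Data.Product using (Σ; ∃; _×_; _,_; proj₁; proj₂)
open import Data.Sum using (_⊎_; inj₁; inj₂)
open import Data.Unit using (⊤)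
open import Function.Bundles using (_⇔_)
open import Relation.Binary.PropositionalEquality using (_≡_)

BoolFun : Set
BoolFun = Σ ℕ (λ n → Vec Bool n → Bool)

arity : (B : List BoolFun) → Fin (length B) → ℕ
arity B i = proj₁ (lookup B i)

fun : (B : List BoolFun) (i : Fin (length B)) → Vec Bool (arity B i) → Bool
fun B i = proj₂ (lookup B i)

data Form (B : List BoolFun) : Set where
  var  : ℕ → Form B
  app  : (i : Fin (length B)) → Vec (Form B) (arity B i) → Form B
  _S_  : Form B → Form B → Form B

record Kripke : Set where
  field
    size  : ℕ
    R     : Fin size → Fin size → Bool
    total : ∀ w → ∃ λ v → R w v ≡ true
    η     : Fin size → List ℕ

open Kripke public

record Path (K : Kripke) : Set where
  field
    p    : ℕ → Fin (size K)
    step : ∀ i → R K (p i) (p (suc i)) ≡ true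

open Path public

mutual
  Sat : {B : List BoolFun} {K : Kripke} → Path K → ℕ → Form B → Set
  Sat {B} {K} π i (var x)    = x ∈ η K (p π i)
  Sat {B} {K} π i (app f φs) =
    Σ (Vec Bool (arity B f)) λ bs → (fun B f bs ≡ true) × SatVec π i φs bs
  Sat {B} {K} π i (φ₁ S φ₂)  =
    ∃ λ ℓ → (ℓ ≤ i) × Sat π ℓ φ₂ × (∀ j → ℓ < j → j ≤ i → Sat π j φ₁)

  SatVec : {B : List BoolFun} {K : Kripke} {n : ℕ} →
           Path K → ℕ → Vec (Form B) n → Vec Bool n → Set
  SatVec π i [] [] = ⊤
  SatVec π i (φ ∷ φs) (b ∷ bs) = ((b ≡ true) ⇔ Sat π i φ) × SatVec π i φs bs

record Instance (B : List BoolFun) : Set where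
  field
    formula   : Form B
    structure : Kripke
    state     : Fin (size structure)

open Instance public

MCYes : (B : List BoolFun) → Instance B → Set
MCYes B I = Σ (Path (structure I)) λ π →
  (p π 0 ≡ state I) × Sat π 0 (formula I)

data Sym : Set where
  𝟎 𝟏 ♯ ⟪ ⟫ tV tF tS : Sym

-- bijective binary numerals (length logarithmic in the value)
encBin : ℕᵇ → List Sym
encBin Bin.zero     = []
encBin 2[1+ n ]     = 𝟎 ∷ encBin n
encBin 1+[2 n ]     = 𝟏 ∷ encBin n

encNat : ℕ → List Sym
encNat n = encBin (Bin.fromℕ n) ++ (♯ ∷ [])

encBool : Bool → Sym
encBool b = if b then 𝟏 else 𝟎

mutual
  -- prefix (Polish) notation; arities are determined by the fixed B
  encForm : {B : List BoolFun} → Form B → List Sym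
  encForm (var x)    = tV ∷ encNat x
  encForm (app i φs) = tF ∷ encNat (toℕ i) ++ encForms φs
  encForm (φ S ψ)    = tS ∷ encForm φ ++ encForm ψ

  encForms : {B : List BoolFun} {n : ℕ} → Vec (Form B) n → List Sym
  encForms []       = []
  encForms (φ ∷ φs) = encForm φ ++ encForms φs

encKripke : Kripke → List Sym
encKripke K =
  encNat (size K)
  ++ concat (V.toList (V.map (λ w → V.toList (V.map (λ v → encBool (R K w v)) (allFin (size K)))) (allFin (size K))))
  ++ concat (V.toList (V.map (λ w → ⟪ ∷ concat (map encNat (η K w)) ++ (⟫ ∷ [])) (allFin (size K))))

encInstance : {B : List BoolFun} → Instance B → List Sym
encInstance I = encForm (formula I) ++ encKripke (structure I) ++ encNat (toℕ (state I))

-- Deterministic Turing machines with a read-only two-way input tape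
-- (with endmarkers) and one read/write work tape.

data Move : Set where
  left stay right : Move

data Action (nQ nΓ : ℕ) : Set where
  halt : Bool → Action nQ nΓ
  go   : Fin nQ → Fin nΓ → Move → Move → Action nQ nΓ -- new state, written symbol, input move, work move

record TM (A : Set) : Set where
  field
    nQ    : ℕ
    nΓ    : ℕ
    start : Fin nQ
    blank : Fin nΓ
    -- input symbol read is 'nothing' on an endmarker
    δ     : Fin nQ → Maybe A → Fin nΓ → Action nQ nΓ

record Config {A : Set} (M : TM A) : Set where
  field
    cstate  : Fin (TM.nQ M)
    inPos   : ℕ              -- 0 = left endmarker, 1..n = input, n+1 = right endmarker
    workPos : ℕ
    tape    : ℕ → Fin (TM.nΓ M)

open Config public

module _ {A : Set} (M : TM A) where
  open TM M

  readIn : List A → ℕ → Maybe A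
  readIn w zero = nothing
  readIn [] (suc i) = nothing
  readIn (a ∷ w) (suc zero) = just a
  readIn (a ∷ w) (suc (suc i)) = readIn w (suc i)

  moveIn : ℕ → Move → ℕ → ℕ
  moveIn n left zero    = zero
  moveIn n left (suc i) = i
  moveIn n stay i       = i
  moveIn n right i      = suc i ⊓ suc n

  moveWork : Move → ℕ → ℕ
  moveWork left zero    = zero
  moveWork left (suc i) = i
  moveWork stay i       = i
  moveWork right i      = suc i

  write : (ℕ → Fin nΓ) → ℕ → Fin nΓ → ℕ → Fin nΓ
  write t pos s j with j ≟ pos
  ... | yes _ = s
  ... | no  _ = t j

  initConfig : Config M
  initConfig = record { cstate = start ; inPos = 0 ; workPos = 0 ; tape = λ _ → blank }

  stepM : List A → Config M → Config M ⊎ Bool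
  stepM w c with δ (cstate c) (readIn w (inPos c)) (tape c (workPos c))
  ... | halt b = inj₂ b
  ... | go q s mi mw = inj₁ (record
          { cstate  = q
          ; inPos   = moveIn (length w) mi (inPos c)
          ; workPos = moveWork mw (workPos c)
          ; tape    = write (tape c) (workPos c) s })

  run : List A → ℕ → Config M ⊎ Bool
  run w zero    = inj₁ initConfig
  run w (suc t) with run w t
  ... | inj₁ c = stepM w c
  ... | inj₂ b = inj₂ b

LogSpace : {A : Set} → TM A → Set
LogSpace {A} M = ∃ λ c → ∀ (w : List A) (t : ℕ) (cfg : Config M) →
  run M w t ≡ inj₁ cfg → workPos cfg ≤ c * (⌊log₂ (length w) ⌋ + 1)

Decides : {A I : Set} → TM A → (I → List A) → (I → Set) → Set
Decides M enc P = ∀ x → Σ ℕ λ t → Σ Bool λ b →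
  (run M (enc x) t ≡ inj₂ b) × ((b ≡ true) ⇔ P x)

InL : {A I : Set} → (I → List A) → (I → Set) → Set
InL {A} enc P = Σ (TM A) λ M → LogSpace M × Decides M enc P

{-# OPTIONS --safe #-}
-- At time 0 the formula φ S ψ just says ψ, and every state starts a path, so
-- the problem is to evaluate a formula over B under the labelling of the given
-- state.  The formula is walked in place: the parent and the children of a
-- token are found by scanning and counting pending subformulae.  Since the
-- functions in B need all their arguments, argument values are kept on a
-- stack, and evaluating the largest argument first bounds its height by the
-- logarithm of the size of the formula.  Registers and stack occupy a number
-- of work cells fixed in advance by counting the input length in binary.
module Submission where

open import Defs
open import Data.List using (List)

open import Data.Bool using (Bool; true; false; _∧_; _xor_; not; if_then_else_; T)
open import Data.Empty using (⊥; ⊥-elim)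
open import Data.Fin using (Fin; zero; suc; toℕ; fromℕ<; splitAt; join; combine; remQuot)
import Data.Fin.Properties as Fin
open import Data.Fin.Properties using (splitAt-join; remQuot-combine; toℕ<n; toℕ-injective; toℕ-fromℕ<)
open import Data.List using ([]; _∷_; _++_; _ʳ++_; length; map; foldr; concat; replicate)
open import Data.List.Membership.Propositional using (_∈_)
open import Data.List.Properties
  using (∷-injectiveˡ; ∷-injectiveʳ; ʳ++-ʳ++; ʳ++-defn; map-ʳ++; length-ʳ++; ++-identityʳ; ++-assoc
        ; length-++; length-map; length-replicate)
open import Data.List.Relation.Unary.All using (All; []; _∷_)
import Data.List.Relation.Unary.All.Properties as All
open import Data.List.Relation.Unary.Any using (here; there)
open import Data.Maybe as Maybe using (Maybe; just; nothing)
open import Data.Nat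
import Data.Nat.Binary.Base as Bin
open import Data.Nat.Binary.Base using (ℕᵇ; 2[1+_]; 1+[2_])
import Data.Nat.Binary.Properties as Bin
open import Data.Nat.Logarithm
open import Data.Nat.Properties
open import Data.Nat.Solver using (module +-*-Solver)
open import Data.Product using (Σ; ∃; ∃₂; _×_; _,_; proj₁; proj₂; map₁)
open import Data.Sum using (_⊎_; inj₁; inj₂)
open import Data.Unit using (⊤; tt)
open import Data.Vec as Vec using (Vec; []; _∷_; lookup; allFin; _[_]≔_)
open import Data.Vec.Properties
  using (lookup∘updateAt; lookup∘updateAt′; lookup-replicate; lookup-map; lookup-allFin
        ; tabulate-cong; tabulate∘lookup)
open import Function using (_∘_; id)
open import Function.Bundles using (_⇔_; mk⇔; Equivalence)
open import Relation.Binary.PropositionalEquality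
open import Relation.Nullary using (yes; no; contradiction)

-- Finite types

-- The bound in `LogSpace` covers all words, including those that encode no instance, on which a
-- program may go astray or run forever. Space and correctness are therefore separated. The machine
-- confines any program between a home cell and a wall, so the bound never refers to what is
-- computed; correctness is shown on encodings only, by derivations of a big-step semantics. Two
-- facts make the fixed space suffice. Since `2 ^ width` exceeds the last input position, a register
-- can hold every position and every count. And a subformula with fewer than `2 ^ d` tokens is
-- evaluated with at most `d` further frames. The run consists of nested loops without an evident
-- measure. Statements about scanning, climbing and evaluating are therefore phrased backwards: a
-- successful run that starts after an object has been dealt with yields one that starts before it.
-- The proofs then become structural inductions on the formula.

record Finite (A : Set) : Set where
  field
    card    : ℕ
    to      : A → Fin card
    from    : Fin card → A
    -- A retract of `Fin card` rather than a bijection: the machine only has to recover a value from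
    -- its code, and spare codes do no harm.
    from-to : ∀ a → from (to a) ≡ a

open Finite public

finite-retract : {A B : Set} → Finite A → (f : B → A) (g : A → B) →
                 (∀ b → g (f b) ≡ b) → Finite B
finite-retract F f g gf = record
  { card    = card F
  ; to      = to F ∘ f
  ; from    = g ∘ from F
  ; from-to = λ b → trans (cong g (from-to F (f b))) (gf b)
  }

finite-⊥ : Finite ⊥
finite-⊥ = record { card = 0 ; to = λ () ; from = λ () ; from-to = λ () }

finite-⊤ : Finite ⊤
finite-⊤ = record { card = 1 ; to = λ _ → zero ; from = λ _ → tt ; from-to = λ _ → refl }

finite-Fin : ∀ n → Finite (Fin n)
finite-Fin n = record { card = n ; to = id ; from = id ; from-to = λ _ → refl }

finite-⊎ : {A B : Set} → Finite A → Finite B → Finite (A ⊎ B)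
finite-⊎ {A} {B} F G = record
  { card    = card F + card G
  ; to      = λ x → join (card F) (card G) (fwd x)
  ; from    = λ i → bwd (splitAt (card F) i)
  ; from-to = λ x → trans (cong bwd (splitAt-join (card F) (card G) (fwd x))) (bwd-fwd x)
  }
  where
  fwd : A ⊎ B → Fin (card F) ⊎ Fin (card G)
  fwd (inj₁ a) = inj₁ (to F a)
  fwd (inj₂ b) = inj₂ (to G b)
  bwd : Fin (card F) ⊎ Fin (card G) → A ⊎ B
  bwd (inj₁ a) = inj₁ (from F a)
  bwd (inj₂ b) = inj₂ (from G b)
  bwd-fwd : ∀ x → bwd (fwd x) ≡ x
  bwd-fwd (inj₁ a) = cong inj₁ (from-to F a)
  bwd-fwd (inj₂ b) = cong inj₂ (from-to G b)

finite-× : {A B : Set} → Finite A → Finite B → Finite (A × B)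
finite-× {A} {B} F G = record
  { card    = card F * card G
  ; to      = λ { (a , b) → combine (to F a) (to G b) }
  ; from    = λ i → bwd (remQuot (card G) i)
  ; from-to = λ { (a , b) → trans (cong bwd (remQuot-combine (to F a) (to G b)))
                                  (cong₂ _,_ (from-to F a) (from-to G b)) }
  }
  where
  bwd : Fin (card F) × Fin (card G) → A × B
  bwd (i , j) = from F i , from G j

finite-ΣFin : ∀ n {B : Fin n → Set} → (∀ i → Finite (B i)) → Finite (Σ (Fin n) B)
finite-ΣFin zero G = record { card = 0 ; to = λ () ; from = λ () ; from-to = λ () }
finite-ΣFin (suc n) {B} G =
  finite-retract (finite-⊎ (G zero) (finite-ΣFin n (G ∘ suc))) fwd bwd bwd-fwd
  where
  fwd : Σ (Fin (suc n)) B → B zero ⊎ Σ (Fin n) (B ∘ suc)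
  fwd (zero  , b) = inj₁ b
  fwd (suc i , b) = inj₂ (i , b)
  bwd : B zero ⊎ Σ (Fin n) (B ∘ suc) → Σ (Fin (suc n)) B
  bwd (inj₁ b)       = zero , b
  bwd (inj₂ (i , b)) = suc i , b
  bwd-fwd : ∀ x → bwd (fwd x) ≡ x
  bwd-fwd (zero  , b) = refl
  bwd-fwd (suc i , b) = refl

finite-Σ : {A : Set} {B : A → Set} → Finite A → (∀ a → Finite (B a)) → Finite (Σ A B)
finite-Σ {A} {B} F G =
  finite-retract (finite-ΣFin (card F) (G ∘ from F)) fwd bwd bwd-fwd
  where
  fwd : Σ A B → Σ (Fin (card F)) (B ∘ from F)
  fwd (a , b) = to F a , subst B (sym (from-to F a)) b
  bwd : Σ (Fin (card F)) (B ∘ from F) → Σ A B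
  bwd (i , b) = from F i , b
  subst-pair : ∀ {a a′} (e : a ≡ a′) (b : B a) → (a′ , subst B e b) ≡ (a , b)
  subst-pair refl b = refl
  bwd-fwd : ∀ x → bwd (fwd x) ≡ x
  bwd-fwd (a , b) = subst-pair (sym (from-to F a)) b

finite-Bool : Finite Bool
finite-Bool = finite-retract (finite-⊎ finite-⊤ finite-⊤)
  (λ { false → inj₁ tt ; true → inj₂ tt })
  (λ { (inj₁ _) → false ; (inj₂ _) → true })
  (λ { false → refl ; true → refl })

finite-Maybe : {A : Set} → Finite A → Finite (Maybe A)
finite-Maybe F = finite-retract (finite-⊎ finite-⊤ F)
  (λ { nothing → inj₁ tt ; (just a) → inj₂ a })
  (λ { (inj₁ _) → nothing ; (inj₂ a) → just a })
  (λ { nothing → refl ; (just a) → refl })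

finite-Vec : {A : Set} → Finite A → ∀ n → Finite (Vec A n)
finite-Vec F zero    = finite-retract finite-⊤ (λ _ → tt) (λ _ → []) (λ { [] → refl })
finite-Vec F (suc n) = finite-retract (finite-× F (finite-Vec F n))
  (λ { (a ∷ as) → a , as }) (λ { (a , as) → a ∷ as }) (λ { (a ∷ as) → refl })

finite-Sym : Finite Sym
finite-Sym = finite-retract (finite-Fin 8)
  (λ { 𝟎 → zero ; 𝟏 → suc zero ; ♯ → suc (suc zero) ; ⟪ → suc (suc (suc zero))
     ; ⟫ → suc (suc (suc (suc zero))) ; tV → suc (suc (suc (suc (suc zero))))
     ; tF → suc (suc (suc (suc (suc (suc zero)))))
     ; tS → suc (suc (suc (suc (suc (suc (suc zero)))))) })
  (λ { zero → 𝟎 ; (suc zero) → 𝟏 ; (suc (suc zero)) → ♯ ; (suc (suc (suc zero))) → ⟪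
     ; (suc (suc (suc (suc zero)))) → ⟫ ; (suc (suc (suc (suc (suc zero))))) → tV
     ; (suc (suc (suc (suc (suc (suc zero)))))) → tF
     ; (suc (suc (suc (suc (suc (suc (suc zero))))))) → tS })
  (λ { 𝟎 → refl ; 𝟏 → refl ; ♯ → refl ; ⟪ → refl ; ⟫ → refl ; tV → refl ; tF → refl ; tS → refl })

-- Programs that sweep over the work tape

symAt : List Sym → ℕ → Maybe Sym
symAt w       zero          = nothing
symAt []      (suc i)       = nothing
symAt (a ∷ w) (suc zero)    = just a
symAt (a ∷ w) (suc (suc i)) = symAt w (suc i)

-- Like `symAt`, this restates a component of the machine model without mentioning a machine:
-- programs get their meaning before the machine that runs them is built.
headMove : ℕ → Move → ℕ → ℕ
headMove n left  i = pred i
headMove n stay  i = i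
headMove n right i = suc i ⊓ suc n

module Programs (Cell : Set) where

  -- `sweep` runs the transducer fR over the work cells away from the home
  -- cell and then fL on the way back, threading one finite state throughout.
  data Prog (X : Set) : Set₁ where
    ret   : X → Prog X
    sweep : {Z : Set} → Finite Z → (fR fL : Z → Cell → Z × Cell) → Z → (Z → Prog X) → Prog X
    move  : Move → Prog X → Prog X
    read  : (Maybe Sym → Prog X) → Prog X
    loop  : {Z Y : Set} → Finite Z → Finite Y → (Z → Prog (Z ⊎ Y)) → Z → (Y → Prog X) → Prog X

  infixr 1 _>>=_ _>>_

  -- Bind substitutes a result into the program text. Tokens or lists of digits may thus come from
  -- infinite types; only sweep states and what crosses a loop are stored as such in the control.
  _>>=_ : {X Y : Set} → Prog X → (X → Prog Y) → Prog Y
  ret x           >>= g = g x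
  sweep F a b s k >>= g = sweep F a b s (λ s → k s >>= g)
  move m k        >>= g = move m (k >>= g)
  read k          >>= g = read (λ a → k a >>= g)
  loop F G f s k  >>= g = loop F G f s (λ y → k y >>= g)

  _>>_ : {X Y : Set} → Prog X → Prog Y → Prog Y
  p >> q = p >>= λ _ → q

  -- The scanned cells come out reversed, ready for the sweep back.
  pass : {Z : Set} → (Z → Cell → Z × Cell) → Z → List Cell → List Cell → Z × List Cell
  pass f s []       acc = s , acc
  pass f s (c ∷ cs) acc = pass f (proj₁ (f s c)) cs (proj₂ (f s c) ∷ acc)

  -- Being inductive, a derivation is at once a proof of termination; a loop that runs forever has
  -- none. This is what lets `Exec⇒Reaches` proceed by plain induction.
  data Exec (w : List Sym) {X : Set} : Prog X → List Cell → ℕ → X → List Cell → ℕ → Set₁ where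
    ret   : ∀ {x cs i} → Exec w (ret x) cs i x cs i
    sweep : ∀ {Z} {F : Finite Z} {fR fL s k cs i s₁ r s₂ cs₂ x cs′ i′} →
            pass fR s cs [] ≡ (s₁ , r) → pass fL s₁ r [] ≡ (s₂ , cs₂) →
            Exec w (k s₂) cs₂ i x cs′ i′ → Exec w (sweep F fR fL s k) cs i x cs′ i′
    move  : ∀ {m k cs i x cs′ i′} →
            Exec w k cs (headMove (length w) m i) x cs′ i′ → Exec w (move m k) cs i x cs′ i′
    read  : ∀ {k cs i x cs′ i′} →
            Exec w (k (symAt w i)) cs i x cs′ i′ → Exec w (read k) cs i x cs′ i′
    loop-more : ∀ {Z Y} {F : Finite Z} {G : Finite Y} {f s k cs i s₁ cs₁ i₁ x cs′ i′} →
            Exec w (f s) cs i (inj₁ s₁) cs₁ i₁ →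
            Exec w (loop F G f s₁ k) cs₁ i₁ x cs′ i′ → Exec w (loop F G f s k) cs i x cs′ i′
    loop-done : ∀ {Z Y} {F : Finite Z} {G : Finite Y} {f s k cs i y cs₁ i₁ x cs′ i′} →
            Exec w (f s) cs i (inj₂ y) cs₁ i₁ →
            Exec w (k y) cs₁ i₁ x cs′ i′ → Exec w (loop F G f s k) cs i x cs′ i′

  exec-bind : ∀ {w} {X Y : Set} {p : Prog X} {g : X → Prog Y} {cs i x cs₁ i₁ y cs₂ i₂} →
              Exec w p cs i x cs₁ i₁ → Exec w (g x) cs₁ i₁ y cs₂ i₂ →
              Exec w (p >>= g) cs i y cs₂ i₂
  exec-bind ret             e′ = e′
  exec-bind (sweep a b e)   e′ = sweep a b (exec-bind e e′)
  exec-bind (move e)        e′ = move (exec-bind e e′)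
  exec-bind (read e)        e′ = read (exec-bind e e′)
  exec-bind (loop-more d e) e′ = loop-more d (exec-bind e e′)
  exec-bind (loop-done d e) e′ = loop-done d (exec-bind e e′)

  -- The control points of a program. A continuation depends on the value it receives, so a point
  -- inside it is paired with that value.
  St : {X : Set} → Prog X → Set
  St (ret x)                = ⊥
  St (sweep {Z} _ _ _ _ k)  = (Z ⊎ Z) ⊎ Σ Z (λ s → St (k s))
  St (move _ k)             = ⊤ ⊎ St k
  St (read k)               = ⊤ ⊎ Σ (Maybe Sym) (λ a → St (k a))
  St (loop {Z} {Y} _ _ f _ k) = (Z ⊎ Σ Z (λ s → St (f s))) ⊎ Σ Y (λ y → St (k y))

  finite-St : {X : Set} (p : Prog X) → Finite (St p)
  finite-St (ret x)          = finite-⊥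
  finite-St (sweep F _ _ _ k) = finite-⊎ (finite-⊎ F F) (finite-Σ F (λ s → finite-St (k s)))
  finite-St (move _ k)       = finite-⊎ finite-⊤ (finite-St k)
  finite-St (read k)         = finite-⊎ finite-⊤ (finite-Σ (finite-Maybe finite-Sym) (λ a → finite-St (k a)))
  finite-St (loop F G f _ k) = finite-⊎ (finite-⊎ F (finite-Σ F (λ s → finite-St (f s))))
                                        (finite-Σ G (λ y → finite-St (k y)))

  entry : {X : Set} (p : Prog X) → St p ⊎ X
  entry (ret x)           = inj₂ x
  entry (sweep _ _ _ s _) = inj₁ (inj₁ (inj₁ s))
  entry (move _ _)        = inj₁ (inj₁ tt)
  entry (read _)          = inj₁ (inj₁ tt)
  entry (loop _ _ _ s _)  = inj₁ (inj₁ (inj₁ s))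

  data Γ : Set where
    blank home wall : Γ
    digit           : Bool → Γ
    cell            : Cell → Γ

  finite-Γ : Finite Cell → Finite Γ
  finite-Γ F = finite-retract (finite-⊎ (finite-Fin 3) (finite-⊎ finite-Bool F))
    (λ { blank → inj₁ zero ; home → inj₁ (suc zero) ; wall → inj₁ (suc (suc zero))
       ; (digit b) → inj₂ (inj₁ b) ; (cell c) → inj₂ (inj₂ c) })
    (λ { (inj₁ zero) → blank ; (inj₁ (suc zero)) → home ; (inj₁ (suc (suc zero))) → wall
       ; (inj₂ (inj₁ b)) → digit b ; (inj₂ (inj₂ c)) → cell c })
    (λ { blank → refl ; home → refl ; wall → refl ; (digit b) → refl ; (cell c) → refl })

  Step : Set → Set
  Step Q = Q × Γ × Move × Move

  into : {A Z X : Set} (k : Z → Prog X) (s : Z) →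
         St (k s) ⊎ X → (A ⊎ Σ Z (λ s → St (k s))) ⊎ X
  into k s (inj₁ q) = inj₁ (inj₂ (s , q))
  into k s (inj₂ x) = inj₂ x

  intoMove : {X : Set} (k : Prog X) → St k ⊎ X → (⊤ ⊎ St k) ⊎ X
  intoMove k (inj₁ q) = inj₁ (inj₂ q)
  intoMove k (inj₂ x) = inj₂ x

  intoBody : {Z Y X : Set} (f : Z → Prog (Z ⊎ Y)) (k : Y → Prog X) (s : Z) →
             St (f s) ⊎ (Z ⊎ Y) →
             ((Z ⊎ Σ Z (λ s → St (f s))) ⊎ Σ Y (λ y → St (k y))) ⊎ X
  intoBody f k s (inj₁ q)        = inj₁ (inj₁ (inj₂ (s , q)))
  intoBody f k s (inj₂ (inj₁ s′)) = inj₁ (inj₁ (inj₁ s′))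
  intoBody f k s (inj₂ (inj₂ y)) = into k y (entry (k y))

  δ : {X : Set} (p : Prog X) → St p → Maybe Sym → Γ → Step (St p ⊎ X)
  δ (sweep F fR fL s₀ k) (inj₁ (inj₁ s)) a (cell c) =
    inj₁ (inj₁ (inj₁ (proj₁ (fR s c)))) , cell (proj₂ (fR s c)) , stay , right
  δ (sweep F fR fL s₀ k) (inj₁ (inj₁ s)) a wall =
    inj₁ (inj₁ (inj₂ s)) , wall , stay , left
  -- In a proper run this is the home cell, from which the pass sets out.
  δ (sweep F fR fL s₀ k) (inj₁ (inj₁ s)) a γ =
    inj₁ (inj₁ (inj₁ s)) , γ , stay , right
  δ (sweep F fR fL s₀ k) (inj₁ (inj₂ s)) a (cell c) =
    inj₁ (inj₁ (inj₂ (proj₁ (fL s c)))) , cell (proj₂ (fL s c)) , stay , left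
  -- In a proper run this is the home cell again, which ends the sweep.
  δ (sweep F fR fL s₀ k) (inj₁ (inj₂ s)) a γ =
    into k s (entry (k s)) , γ , stay , stay
  δ (sweep F fR fL s₀ k) (inj₂ (s , q)) a γ = map₁ (into k s) (δ (k s) q a γ)
  δ (move m k) (inj₁ _) a γ = intoMove k (entry k) , γ , m , stay
  δ (move m k) (inj₂ q) a γ = map₁ (intoMove k) (δ k q a γ)
  δ (read k) (inj₁ _) a γ = into k a (entry (k a)) , γ , stay , stay
  δ (read k) (inj₂ (b , q)) a γ = map₁ (into k b) (δ (k b) q a γ)
  δ (loop F G f s₀ k) (inj₁ (inj₁ s)) a γ = intoBody f k s (entry (f s)) , γ , stay , stay
  δ (loop F G f s₀ k) (inj₁ (inj₂ (s , q))) a γ = map₁ (intoBody f k s) (δ (f s) q a γ)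
  δ (loop F G f s₀ k) (inj₂ (y , q)) a γ = map₁ (into k y) (δ (k y) q a γ)

  noRight : Move → Move
  noRight right = stay
  noRight m     = m

  -- Enforces the space bound whatever the program does.
  clamp : {Q : Set} → Γ → Step Q → Step Q
  clamp wall (q , γ , mi , mw) = q , wall , mi , noRight mw
  clamp _    s                 = s

  clamp-map : {Q R : Set} (g : Q → R) (γ : Γ) (s : Step Q) → clamp γ (map₁ g s) ≡ map₁ g (clamp γ s)
  clamp-map g blank     s = refl
  clamp-map g home      s = refl
  clamp-map g wall      s = refl
  clamp-map g (digit _) s = refl
  clamp-map g (cell _)  s = refl

  nth : List Γ → ℕ → Γ
  nth []       i       = blank
  nth (γ ∷ γs) zero    = γ
  nth (γ ∷ γs) (suc i) = nth γs i

  -- Tapes are handled as zippers `l ʳ++ r`: `l` lists what lies to the left of the head, nearest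
  -- symbol first, so that `length l` is the head position.
  nth-ʳ++ : ∀ l r i → nth (l ʳ++ r) (length l + i) ≡ nth r i
  nth-ʳ++ []      r i = refl
  nth-ʳ++ (x ∷ l) r i =
    trans (cong (nth (l ʳ++ x ∷ r)) (sym (+-suc (length l) i))) (nth-ʳ++ l (x ∷ r) (suc i))

  nth-ʳ++-other : ∀ l {xs ys} k → (∀ i → i ≢ k → nth xs i ≡ nth ys i) →
                  ∀ j → j ≢ length l + k → nth (l ʳ++ xs) j ≡ nth (l ʳ++ ys) j
  nth-ʳ++-other []      k e j ne = e j ne
  nth-ʳ++-other (x ∷ l) k e j ne =
    nth-ʳ++-other l (suc k)
      (λ { zero _ → refl ; (suc i) i≢ → e i (λ eq → i≢ (cong suc eq)) })
      j (λ eq → ne (trans eq (+-suc (length l) k)))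

  layout : List Cell → List Γ
  layout cs = home ∷ map cell cs ++ wall ∷ []

  -- Simulation of programs inside a Turing machine

  module Hosting (finiteCell : Finite Cell)
                 (nQ : ℕ) (q₀ : Fin nQ)
                 (δM : Fin nQ → Maybe Sym → Fin (card (finite-Γ finiteCell)) →
                       Action nQ (card (finite-Γ finiteCell)))
                 (w : List Sym) where

    FΓ : Finite Γ
    FΓ = finite-Γ finiteCell

    M : TM Sym
    M = record { nQ = nQ ; nΓ = card FΓ ; start = q₀ ; blank = to FΓ blank ; δ = δM }

    -- Agreement is pointwise, which spares function extensionality; the actual tape function is
    -- carried along existentially in `Reaches`.
    record TapeIs (t : ℕ → Fin (card FΓ)) (γs : List Γ) : Set where
      constructor mkTape
      field at : ∀ i → t i ≡ to FΓ (nth γs i)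

    open TapeIs public

    config : Fin nQ → ℕ → ℕ → (ℕ → Fin (card FΓ)) → Config M
    config q i j t = record { cstate = q ; inPos = i ; workPos = j ; tape = t }

    -- `P` is asserted of each configuration that a step leaves. With `P` a bound on the work head,
    -- this collects the space used before the wall is in place.
    data Steps (P : Config M → Set) : Config M → Config M → Set where
      done : ∀ {c} → Steps P c c
      next : ∀ {c c₁ c₂} → P c → stepM M w c ≡ inj₁ c₁ → Steps P c₁ c₂ → Steps P c c₂

    _∙_ : ∀ {P c c₁ c₂} → Steps P c c₁ → Steps P c₁ c₂ → Steps P c c₂
    done       ∙ s′ = s′
    next p e s ∙ s′ = next p e (s ∙ s′)

    readIn-symAt : ∀ v i → readIn M v i ≡ symAt v i
    readIn-symAt v       zero          = refl
    readIn-symAt []      (suc i)       = refl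
    readIn-symAt (a ∷ v) (suc zero)    = refl
    readIn-symAt (a ∷ v) (suc (suc i)) = readIn-symAt v (suc i)

    moveIn-headMove : ∀ n m i → moveIn M n m i ≡ headMove n m i
    moveIn-headMove n left  zero    = refl
    moveIn-headMove n left  (suc i) = refl
    moveIn-headMove n stay  i       = refl
    moveIn-headMove n right i       = refl

    act : Step (Fin nQ) → Action nQ (card FΓ)
    act (q , γ , mi , mw) = go q (to FΓ γ) mi mw

    write-tape : ∀ {t} l {γ r} γ′ → TapeIs t (l ʳ++ γ ∷ r) →
                 TapeIs (write M t (length l) (to FΓ γ′)) (l ʳ++ γ′ ∷ r)
    at (write-tape l {γ} {r} γ′ T) j with j ≟ length l
    ... | yes refl = cong (to FΓ) (sym (trans (cong (nth (l ʳ++ γ′ ∷ r)) (sym (+-identityʳ (length l))))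
                                              (nth-ʳ++ l (γ′ ∷ r) 0)))
    ... | no  ne   = trans (at T j) (cong (to FΓ)
          (nth-ʳ++-other l {γ ∷ r} {γ′ ∷ r} 0
            (λ { zero ne → contradiction refl ne ; (suc i) _ → refl })
            j (λ e → ne (trans e (+-identityʳ _)))))

    tape-head : ∀ {t} l {γ r} → TapeIs t (l ʳ++ γ ∷ r) → t (length l) ≡ to FΓ γ
    tape-head {t} l {γ} {r} T = trans (at T (length l)) (cong (to FΓ)
      (trans (cong (nth (l ʳ++ γ ∷ r)) (sym (+-identityʳ (length l)))) (nth-ʳ++ l (γ ∷ r) 0)))

    step-at : ∀ {q t i} l {γ r} (s : Step (Fin nQ)) → TapeIs t (l ʳ++ γ ∷ r) →
              δM q (symAt w i) (to FΓ γ) ≡ act s →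
              stepM M w (config q i (length l) t) ≡
              inj₁ (config (proj₁ s) (headMove (length w) (proj₁ (proj₂ (proj₂ s))) i)
                           (moveWork M (proj₂ (proj₂ (proj₂ s))) (length l))
                           (write M t (length l) (to FΓ (proj₁ (proj₂ s)))))
    step-at {i = i} l (_ , _ , mi , _) T e
      rewrite tape-head l T | readIn-symAt w i | e | moveIn-headMove (length w) mi i = refl

    -- `h` embeds the control points of `p` into the machine and sends each result to the state
    -- where the surrounding program goes on. A subprogram is hosted by the same machine, with `h`
    -- composed with the map into its parent.
    record Hosted {X : Set} (p : Prog X) (h : St p ⊎ X → Fin nQ) : Set where
      constructor hosted
      field simulates : ∀ q a γ → δM (h (inj₁ q)) a (to FΓ γ) ≡ act (clamp γ (map₁ h (δ p q a γ)))

    open Hosted public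

    Unconstrained : Config M → Set
    Unconstrained _ = ⊤

    record Reaches (P : Config M → Set) (q : Fin nQ) (i j : ℕ) (t : ℕ → Fin (card FΓ))
                   (q′ : Fin nQ) (i′ j′ : ℕ) (γs : List Γ) : Set where
      constructor reaches
      field
        tape′   : ℕ → Fin (card FΓ)
        tape-is : TapeIs tape′ γs
        steps   : Steps P (config q i j t) (config q′ i′ j′ tape′)

    infixr 2 _▷_

    _▷_ : ∀ {P q i j t q₁ i₁ j₁ γs q₂ i₂ j₂ γs₂} → Reaches P q i j t q₁ i₁ j₁ γs →
          (∀ {t₁} → TapeIs t₁ γs → Reaches P q₁ i₁ j₁ t₁ q₂ i₂ j₂ γs₂) →
          Reaches P q i j t q₂ i₂ j₂ γs₂
    reaches t₁ T₁ s₁ ▷ f with f T₁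
    ... | reaches t₂ T₂ s₂ = reaches t₂ T₂ (s₁ ∙ s₂)

    arrived : ∀ {P q i j t γs} → TapeIs t γs → Reaches P q i j t q i j γs
    arrived T = reaches _ T done

    tick : ∀ {P q t i} l {γ r} (s : Step (Fin nQ)) → P (config q i (length l) t) →
           δM q (symAt w i) (to FΓ γ) ≡ act s → TapeIs t (l ʳ++ γ ∷ r) →
           Reaches P q i (length l) t
                   (proj₁ s) (headMove (length w) (proj₁ (proj₂ (proj₂ s))) i)
                   (moveWork M (proj₂ (proj₂ (proj₂ s))) (length l)) (l ʳ++ proj₁ (proj₂ s) ∷ r)
    tick l s p e T = reaches _ (write-tape l _ T) (next p (step-at l s T e) done)

    hop : ∀ {X} {p : Prog X} {h} → Hosted p h → ∀ q {t i} l γ r → TapeIs t (l ʳ++ γ ∷ r) →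
          let s = clamp γ (map₁ h (δ p q (symAt w i) γ)) in
          Reaches Unconstrained (h (inj₁ q)) i (length l) t
                  (proj₁ s) (headMove (length w) (proj₁ (proj₂ (proj₂ s))) i)
                  (moveWork M (proj₂ (proj₂ (proj₂ s))) (length l)) (l ʳ++ proj₁ (proj₂ s) ∷ r)
    hop {p = p} {h} H q {i = i} l γ r T =
      tick l (clamp γ (map₁ h (δ p q (symAt w i) γ))) tt (simulates H q (symAt w i) γ) T

    moveWork-left : ∀ m → moveWork M left m ≡ pred m
    moveWork-left zero    = refl
    moveWork-left (suc m) = refl

    module _ {X Z : Set} {F : Finite Z} {fR fL : Z → Cell → Z × Cell} {s₀ : Z} {k : Z → Prog X}
             {h : St (sweep F fR fL s₀ k) ⊎ X → Fin nQ} (H : Hosted (sweep F fR fL s₀ k) h) where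

      sweep-right : ∀ {i t} s cs acc → TapeIs t ((map cell acc ++ home ∷ []) ʳ++ map cell cs ++ wall ∷ []) →
        Reaches Unconstrained (h (inj₁ (inj₁ (inj₁ s)))) i (length (map cell acc ++ home ∷ [])) t
                (h (inj₁ (inj₁ (inj₁ (proj₁ (pass fR s cs acc)))))) i
                (length (map cell (proj₂ (pass fR s cs acc)) ++ home ∷ []))
                ((map cell (proj₂ (pass fR s cs acc)) ++ home ∷ []) ʳ++ wall ∷ [])
      sweep-right s []       acc T = arrived T
      sweep-right s (c ∷ cs) acc T =
        hop H (inj₁ (inj₁ s)) (map cell acc ++ home ∷ []) (cell c) (map cell cs ++ wall ∷ []) T
        ▷ sweep-right (proj₁ (fR s c)) cs (proj₂ (fR s c) ∷ acc)

      sweep-left : ∀ {i t} s cs acc →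
        TapeIs t ((map cell cs ++ home ∷ []) ʳ++ map cell acc ++ wall ∷ []) →
        Reaches Unconstrained (h (inj₁ (inj₁ (inj₂ s)))) i (moveWork M left (length (map cell cs ++ home ∷ []))) t
                (h (inj₁ (inj₁ (inj₂ (proj₁ (pass fL s cs acc)))))) i 0
                (layout (proj₂ (pass fL s cs acc)))
      sweep-left s []       acc T = arrived T
      sweep-left s (c ∷ cs) acc T =
        hop H (inj₁ (inj₂ s)) (map cell cs ++ home ∷ []) (cell c) (map cell acc ++ wall ∷ []) T
        ▷ sweep-left (proj₁ (fL s c)) cs (proj₂ (fL s c) ∷ acc)

    -- Induction on the derivation rather than on the program, because `loop-more` comes back to the
    -- same loop. The body of a loop is hosted through `intoBody`, which redirects its exits to the
    -- loop head or to the continuation.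
    Exec⇒Reaches : {X : Set} {p : Prog X} (h : St p ⊎ X → Fin nQ) → Hosted p h →
      ∀ {cs i x cs′ i′ t} → Exec w p cs i x cs′ i′ → TapeIs t (layout cs) →
      Reaches Unconstrained (h (entry p)) i 0 t (h (inj₂ x)) i′ 0 (layout cs′)
    Exec⇒Reaches h H ret T = arrived T
    Exec⇒Reaches h H {cs = cs} (sweep {k = k} {s₁ = s₁} {r} {s₂} {cs₂} e₁ e₂ ex) T =
      hop H _ [] home _ T ▷ λ T₁ →
      subst (λ z → Reaches _ _ _ _ _ (h (inj₁ (inj₁ (inj₁ (proj₁ z))))) _
                           (length (map cell (proj₂ z) ++ home ∷ []))
                           ((map cell (proj₂ z) ++ home ∷ []) ʳ++ wall ∷ [])) e₁
            (sweep-right H _ cs [] T₁) ▷ λ T₂ →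
      hop H (inj₁ (inj₁ s₁)) (map cell r ++ home ∷ []) wall [] T₂ ▷ λ T₃ →
      subst (λ z → Reaches _ _ _ _ _ (h (inj₁ (inj₁ (inj₂ (proj₁ z))))) _ 0 (layout (proj₂ z))) e₂
             (sweep-left H s₁ r [] T₃) ▷ λ T₄ →
      hop H (inj₁ (inj₂ s₂)) [] home (map cell cs₂ ++ wall ∷ []) T₄ ▷ λ T₅ →
      Exec⇒Reaches (λ q → h (into k s₂ q)) (hosted λ q a γ → simulates H (inj₂ (s₂ , q)) a γ) ex T₅
    Exec⇒Reaches h H (move {k = k} ex) T =
      hop H (inj₁ tt) [] home _ T ▷ λ T₁ →
      Exec⇒Reaches (λ q → h (intoMove k q)) (hosted λ q a γ → simulates H (inj₂ q) a γ) ex T₁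
    Exec⇒Reaches h H (read {k} {i = i} ex) T =
      hop H (inj₁ tt) [] home _ T ▷ λ T₁ →
      Exec⇒Reaches (λ q → h (into k (symAt w i) q))
        (hosted λ q a γ → simulates H (inj₂ (symAt w i , q)) a γ) ex T₁
    Exec⇒Reaches h H (loop-more {F = F} {G} {f} {s} {k} {s₁ = s₁} d ex) T =
      hop H (inj₁ (inj₁ s)) [] home _ T ▷ λ T₁ →
      Exec⇒Reaches (λ q → h (intoBody f k s q))
        (hosted λ q a γ → simulates H (inj₁ (inj₂ (s , q))) a γ) d T₁ ▷ λ T₂ →
      Exec⇒Reaches {p = loop F G f s₁ k} h
        -- The transitions of a loop do not depend on its initial value, but this is visible only
        -- once the control point is split into cases.
        (hosted λ { (inj₁ (inj₁ s)) → simulates H (inj₁ (inj₁ s))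
                  ; (inj₁ (inj₂ q)) → simulates H (inj₁ (inj₂ q))
                  ; (inj₂ q)        → simulates H (inj₂ q) }) ex T₂
    Exec⇒Reaches h H (loop-done {f = f} {s} {k} {y = y} d ex) T =
      hop H (inj₁ (inj₁ s)) [] home _ T ▷ λ T₁ →
      Exec⇒Reaches (λ q → h (intoBody f k s q))
        (hosted λ q a γ → simulates H (inj₁ (inj₂ (s , q))) a γ) d T₁ ▷ λ T₂ →
      Exec⇒Reaches (λ q → h (into k y q)) (hosted λ q a γ → simulates H (inj₂ (y , q)) a γ) ex T₂

-- Binary counters and the machine running a program

bit : Bool → ℕ
bit false = 0
bit true  = 1

value : List Bool → ℕ
value []       = 0
value (b ∷ bs) = bit b + 2 * value bs

increment : List Bool → List Bool
increment []           = true ∷ []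
increment (false ∷ bs) = true ∷ bs
increment (true ∷ bs)  = false ∷ increment bs

increments : ℕ → List Bool → List Bool
increments zero    bs = bs
increments (suc k) bs = increments k (increment bs)

value-increment : ∀ bs → value (increment bs) ≡ suc (value bs)
value-increment []           = refl
value-increment (false ∷ bs) = refl
value-increment (true ∷ bs)  =
  trans (cong (2 *_) (value-increment bs)) (*-suc 2 (value bs))

value-increments : ∀ k bs → value (increments k bs) ≡ k + value bs
value-increments zero    bs = refl
value-increments (suc k) bs =
  trans (value-increments k (increment bs))
        (trans (cong (k +_) (value-increment bs)) (+-suc k (value bs)))

value< : ∀ bs → value bs < 2 ^ length bs
value< []           = s≤s z≤n
value< (false ∷ bs) = *-monoʳ-< 2 (value< bs)
value< (true ∷ bs)  = ≤-trans (≤-reflexive (sym (*-suc 2 (value bs)))) (*-monoʳ-≤ 2 (value< bs))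

data TopBitSet : List Bool → Set where
  top  : TopBitSet (true ∷ [])
  _∷ᵗ_ : ∀ b {bs} → TopBitSet bs → TopBitSet (b ∷ bs)

increment-topBitSet : ∀ {bs} → TopBitSet bs → TopBitSet (increment bs)
increment-topBitSet top             = false ∷ᵗ top
increment-topBitSet (false ∷ᵗ t)    = true ∷ᵗ t
increment-topBitSet (true ∷ᵗ t)     = false ∷ᵗ increment-topBitSet t

increments-topBitSet : ∀ k {bs} → TopBitSet bs → TopBitSet (increments k bs)
increments-topBitSet zero    t = t
increments-topBitSet (suc k) t = increments-topBitSet k (increment-topBitSet t)

topBitSet-value : ∀ {bs} → TopBitSet bs → 2 ^ length bs ≤ 2 * value bs
topBitSet-value top                = ≤-refl
topBitSet-value {b ∷ bs} (_ ∷ᵗ t) =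
  *-monoʳ-≤ 2 (≤-trans (topBitSet-value t) (m≤n+m (2 * value bs) (bit b)))

length-increment : ∀ bs → length bs ≤ length (increment bs)
length-increment []           = z≤n
length-increment (false ∷ bs) = ≤-refl
length-increment (true ∷ bs)  = s≤s (length-increment bs)

length-increments : ∀ k bs → length bs ≤ length (increments k bs)
length-increments zero    bs = ≤-refl
length-increments (suc k) bs = ≤-trans (length-increment bs) (length-increments k (increment bs))

-- Here `suc L` will be the position of the wall. For `n` at least 1, `suc n ≤ 2 * n` gives
-- `2 ^ L ≤ 4 * n`, so `suc L` is at most three plus the logarithm, which is rounded up to a
-- multiple of the required form. For the empty input `L` is at most 1.
logBound : ∀ n L → 2 ^ L ≤ 2 * suc n → suc L ≤ 4 * (⌊log₂ n ⌋ + 1)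
logBound zero    zero          h = s≤s z≤n
logBound zero    (suc zero)    h = s≤s (s≤s z≤n)
logBound zero    (suc (suc L)) h =
  ⊥-elim (<⇒≱ (≤-trans (s≤s (s≤s (s≤s z≤n))) (*-monoʳ-≤ 2 (*-monoʳ-≤ 2 (m^n>0 2 L)))) h)
logBound (suc m) L h = begin
  suc L                      ≡⟨ cong suc (sym (⌊log₂[2^n]⌋≡n L)) ⟩
  suc ⌊log₂ 2 ^ L ⌋          ≤⟨ s≤s (⌊log₂⌋-mono-≤ (≤-trans h (*-monoʳ-≤ 2 le))) ⟩
  suc ⌊log₂ 2 * (2 * n) ⌋    ≡⟨ cong suc (⌊log₂[2*b]⌋≡1+⌊log₂b⌋ (2 * n)) ⟩
  2 + ⌊log₂ 2 * n ⌋          ≡⟨ cong (2 +_) (⌊log₂[2*b]⌋≡1+⌊log₂b⌋ n) ⟩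
  3 + ⌊log₂ n ⌋              ≤⟨ +-mono-≤ (n≤1+n 3) (m≤m+n ⌊log₂ n ⌋ _) ⟩
  4 + 4 * ⌊log₂ n ⌋          ≡⟨ sym (*-suc 4 _) ⟩
  4 * suc ⌊log₂ n ⌋          ≡⟨ cong (4 *_) (+-comm 1 _) ⟩
  4 * (⌊log₂ n ⌋ + 1)        ∎
  where
  open ≤-Reasoning
  n = suc m
  le : suc n ≤ 2 * n
  le = ≤-trans (s≤s (m≤m+n n (m + 0))) (≤-reflexive (sym (+-suc n (m + 0))))

symAt-just : ∀ w {i} → i < length w → ∃ λ a → symAt w (suc i) ≡ just a
symAt-just (a ∷ w) {zero}  _         = a , refl
symAt-just (_ ∷ w) {suc i} (s≤s i<n) = symAt-just w i<n

symAt-end : ∀ w → symAt w (suc (length w)) ≡ nothing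
symAt-end []      = refl
symAt-end (_ ∷ w) = symAt-end w

module Machine (Cell : Set) (finiteCell : Finite Cell) (c₀ : Cell)
               (prog : Programs.Prog Cell Bool) where
  open Programs Cell

  -- The machine first counts the input length plus one in binary (carry,
  -- return, test), then turns the digits into empty cells and puts the wall
  -- behind them (reset, rewind).
  data Init : Set where
    begin carry return test reset rewind : Init

  finite-Init : Finite Init
  finite-Init = finite-retract (finite-Fin 6)
    (λ { begin → zero ; carry → suc zero ; return → suc (suc zero)
       ; test → suc (suc (suc zero)) ; reset → suc (suc (suc (suc zero)))
       ; rewind → suc (suc (suc (suc (suc zero)))) })
    (λ { zero → begin ; (suc zero) → carry ; (suc (suc zero)) → return
       ; (suc (suc (suc zero))) → test ; (suc (suc (suc (suc zero)))) → reset
       ; (suc (suc (suc (suc (suc zero))))) → rewind })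
    (λ { begin → refl ; carry → refl ; return → refl ; test → refl ; reset → refl ; rewind → refl })

  Control : Set
  Control = Init ⊎ (St prog ⊎ Bool)

  FQ : Finite Control
  FQ = finite-⊎ finite-Init (finite-⊎ (finite-St prog) finite-Bool)

  -- One increment precedes the first test of the input, so the count ends at one more than the
  -- input length, with the input head on the right endmarker.
  δ-init : Init → Maybe Sym → Γ → Step Control
  δ-init begin  _        _            = inj₁ carry , home , stay , right
  δ-init carry  _        (digit true) = inj₁ carry , digit false , stay , right
  δ-init carry  _        _            = inj₁ return , digit true , stay , left
  δ-init return _        home         = inj₁ test , home , right , stay
  δ-init return _        γ            = inj₁ return , γ , stay , left
  δ-init test   nothing  γ            = inj₁ reset , γ , stay , right
  δ-init test   (just _) γ            = inj₁ carry , γ , stay , right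
  δ-init reset  _        blank        = inj₁ rewind , wall , stay , left
  δ-init reset  _        γ            = inj₁ reset , cell c₀ , stay , right
  δ-init rewind _        home         = inj₂ (entry prog) , home , stay , stay
  δ-init rewind _        γ            = inj₁ rewind , γ , stay , left

  FΓ : Finite Γ
  FΓ = finite-Γ finiteCell

  emit : Step (Fin (card FQ)) → Action (card FQ) (card FΓ)
  emit (q , γ , mi , mw) = go q (to FΓ γ) mi mw

  δ-control : Control → Maybe Sym → Γ → Action (card FQ) (card FΓ)
  δ-control (inj₁ q)        a γ = emit (map₁ (to FQ) (δ-init q a γ))
  δ-control (inj₂ (inj₁ q)) a γ = emit (clamp γ (map₁ (to FQ ∘ inj₂) (δ prog q a γ)))
  δ-control (inj₂ (inj₂ b)) a γ = halt b

  δ-machine : Fin (card FQ) → Maybe Sym → Fin (card FΓ) → Action (card FQ) (card FΓ)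
  δ-machine q a γ = δ-control (from FQ q) a (from FΓ γ)

  module On = Hosting finiteCell (card FQ) (to FQ (inj₁ begin)) δ-machine

  machine : TM Sym
  machine = record { nQ = card FQ ; nΓ = card FΓ ; start = to FQ (inj₁ begin)
                   ; blank = to FΓ blank ; δ = δ-machine }

  δ-machine-to : ∀ q a γ → δ-machine (to FQ q) a (to FΓ γ) ≡ δ-control q a γ
  δ-machine-to q a γ = cong₂ (λ q γ → δ-control q a γ) (from-to FQ q) (from-to FΓ γ)

  module Input (w : List Sym) where
    open On w hiding (FΓ)

    prog-hosted : Hosted prog (to FQ ∘ inj₂)
    prog-hosted = hosted λ q a γ → δ-machine-to (inj₂ (inj₁ q)) a γ

    runFrom : Config M → ℕ → Config M ⊎ Bool
    runFrom c zero = inj₁ c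
    runFrom c (suc t) with runFrom c t
    ... | inj₁ c′ = stepM M w c′
    ... | inj₂ b  = inj₂ b

    runFrom-step : ∀ {c c′} t → stepM M w c ≡ inj₁ c′ → runFrom c (suc t) ≡ runFrom c′ t
    runFrom-step zero    e = e
    runFrom-step (suc t) e rewrite runFrom-step t e = refl

    run-runFrom : ∀ t → run M w t ≡ runFrom (initConfig M) t
    run-runFrom zero = refl
    run-runFrom (suc t) rewrite run-runFrom t with runFrom (initConfig M) t
    ... | inj₁ c = refl
    ... | inj₂ b = refl

    runFrom-halts : ∀ {P c c′ b} → Steps P c c′ → stepM M w c′ ≡ inj₂ b →
                    ∃ λ t → runFrom c t ≡ inj₂ b
    runFrom-halts done e = 1 , e
    runFrom-halts (next _ e s) h with runFrom-halts s h
    ... | t , r = suc t , trans (runFrom-step t e) r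

    Within : ℕ → Config M → Set
    Within b c = workPos c ≤ b

    Safe : ℕ → Config M → Set
    Safe b c = ∀ t c′ → runFrom c t ≡ inj₁ c′ → workPos c′ ≤ b

    steps-safe : ∀ {b c c′} → Steps (Within b) c c′ → Safe b c′ → Safe b c
    steps-safe done            s = s
    steps-safe (next p e rest) s zero    c refl = p
    steps-safe (next p e rest) s (suc t) c r    =
      steps-safe rest s t c (trans (sym (runFrom-step t e)) r)

    record Walled (m : ℕ) (c : Config M) : Set where
      field
        control  : St prog ⊎ Bool
        state-is : cstate c ≡ to FQ (inj₂ control)
        before   : workPos c ≤ m
        wall-at  : tape c m ≡ to FΓ wall

    open Walled

    moveWork-≤ : ∀ mv {j m} → j ≤ m → moveWork M (noRight mv) j ≤ m
    moveWork-≤ left  {zero}  h = h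
    moveWork-≤ left  {suc j} h = <⇒≤ h
    moveWork-≤ stay          h = h
    moveWork-≤ right         h = h

    moveWork-< : ∀ mv {j m} → j < m → moveWork M mv j ≤ m
    moveWork-< left  {zero}  h = <⇒≤ h
    moveWork-< left  {suc j} h = <⇒≤ (<⇒≤ h)
    moveWork-< stay          h = <⇒≤ h
    moveWork-< right         h = h

    write-other : ∀ t {j m} s → m ≢ j → write M t j s m ≡ t m
    write-other t {j} {m} s ne with m ≟ j
    ... | yes e = contradiction e ne
    ... | no _  = refl

    write-same : ∀ t j s → write M t j s j ≡ s
    write-same t j s with j ≟ j
    ... | yes _ = refl
    ... | no ne = contradiction refl ne

    -- On the wall, `clamp` restores the wall and cancels a move to the right. Before it, one step
    -- reaches position `m` at most and writes elsewhere. Nothing is assumed about the program or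
    -- the input.
    walled-step : ∀ {m c c′} → Walled m c → stepM M w c ≡ inj₁ c′ → Walled m c′
    walled-step {m} {record { cstate = q ; inPos = i ; workPos = j ; tape = t }} W e
      with control W | state-is W
    ... | z | refl rewrite from-to FQ (inj₂ z) with z | m ≟ j
    ... | inj₂ b | _ = contradiction e λ ()
    ... | inj₁ q′ | yes refl
      rewrite wall-at W | from-to FΓ wall with refl ← e = record
      { control  = proj₁ (δ prog q′ (readIn M w i) wall)
      ; state-is = refl
      ; before   = moveWork-≤ (proj₂ (proj₂ (proj₂ (δ prog q′ (readIn M w i) wall)))) ≤-refl
      ; wall-at  = write-same t m (to FΓ wall) }
    ... | inj₁ q′ | no ne
      rewrite clamp-map (to FQ ∘ inj₂) (from FΓ (t j)) (δ prog q′ (readIn M w i) (from FΓ (t j)))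
      with clamp (from FΓ (t j)) (δ prog q′ (readIn M w i) (from FΓ (t j))) | e
    ... | q″ , γ″ , mi , mw | refl = record
      { control  = q″
      ; state-is = refl
      ; before   = moveWork-< mw (≤∧≢⇒< (before W) (λ e → ne (sym e)))
      ; wall-at  = trans (write-other t (to FΓ γ″) ne) (wall-at W) }

    walled-safe : ∀ {m c} → Walled m c → Safe m c
    walled-safe {m} {c} W t c′ e = before (go-on t e)
      where
      go-on : ∀ t {c′} → runFrom c t ≡ inj₁ c′ → Walled m c′
      go-on zero    refl = W
      go-on (suc t) e with runFrom c t in r | e
      ... | inj₁ c₁ | e′ = walled-step (go-on t r) e′

    digits : List Bool → List Γ
    digits = map digit

    -- A tape list reads as blank beyond its end, so the blank under the head may be made explicit
    -- when the counter grows or the wall is built.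
    pad-blank : ∀ {t} l → TapeIs t (l ʳ++ []) → TapeIs t (l ʳ++ blank ∷ [])
    at (pad-blank l T) i = trans (at T i) (cong (to FΓ) (same l λ { zero → refl ; (suc _) → refl }))
      where
      same : ∀ l {xs ys} → (∀ i → nth xs i ≡ nth ys i) → nth (l ʳ++ xs) i ≡ nth (l ʳ++ ys) i
      same []      e = e i
      same (x ∷ l) e = same l (λ { zero → refl ; (suc i) → e i })

    init-step : ∀ {b t i} l {r} q γ → length l ≤ b → TapeIs t (l ʳ++ γ ∷ r) →
      let s = δ-init q (symAt w i) γ in
      Reaches (Within b) (to FQ (inj₁ q)) i (length l) t
        (to FQ (proj₁ s)) (headMove (length w) (proj₁ (proj₂ (proj₂ s))) i)
        (moveWork M (proj₂ (proj₂ (proj₂ s))) (length l)) (l ʳ++ proj₁ (proj₂ s) ∷ r)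
    init-step {i = i} l q γ h =
      tick l (map₁ (to FQ) (δ-init q (symAt w i) γ)) h (δ-machine-to (inj₁ q) (symAt w i) γ)


    carry-run : ∀ {b t i} l bs → length l + length (increment bs) ≤ b →
      TapeIs t (l ʳ++ digits bs) →
      Reaches (Within b) (to FQ (inj₁ carry)) i (length l) t
        (to FQ (inj₁ return)) i (moveWork M left (length l)) (l ʳ++ digits (increment bs))
    carry-run l [] h T = init-step l carry blank (m+n≤o⇒m≤o (length l) h) (pad-blank l T)
    carry-run l (false ∷ bs) h T = init-step l carry (digit false) (m+n≤o⇒m≤o (length l) h) T
    carry-run {b} l (true ∷ bs) h T =
      init-step l carry (digit true) (m+n≤o⇒m≤o (length l) h) T ▷ λ T₁ →
      carry-run (digit false ∷ l) bs (subst (_≤ b) (+-suc (length l) _) h) T₁ ▷ λ T₂ →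
      init-step l return (digit false) (m+n≤o⇒m≤o (length l) h) T₂

    count-run : ∀ {b t i} k bs → i + k ≡ length w →
      1 + length (increments (suc k) bs) ≤ b → TapeIs t (home ∷ digits bs) →
      Reaches (Within b) (to FQ (inj₁ carry)) i 1 t
        (to FQ (inj₁ reset)) (suc (length w)) 1 (home ∷ digits (increments (suc k) bs))
    count-run {b} {i = i} k bs e h T =
      carry-run (home ∷ []) bs (≤-trans (s≤s (length-increments k (increment bs))) h) T ▷ λ T₁ →
      init-step [] return home z≤n T₁ ▷ λ {t₂} T₂ →
      subst (λ p → Reaches (Within b) (to FQ (inj₁ test)) p 0 t₂ (to FQ (inj₁ reset))
                           (suc (length w)) 1 (home ∷ digits (increments (suc k) bs)))
            (sym (m≤n⇒m⊓n≡m (s≤s (m+n≤o⇒m≤o i (≤-reflexive e)))))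
        (advance k e h T₂)
      where
      advance : ∀ {t} k → i + k ≡ length w → 1 + length (increments (suc k) bs) ≤ b →
        TapeIs t (home ∷ digits (increment bs)) →
        Reaches (Within b) (to FQ (inj₁ test)) (suc i) 0 t
          (to FQ (inj₁ reset)) (suc (length w)) 1 (home ∷ digits (increments (suc k) bs))
      advance zero e h T with trans (sym (+-identityʳ i)) e
      ... | refl with symAt w (suc i) in a | symAt-end w | init-step {i = suc i} [] test home z≤n T
      ... | _ | refl | R = R
      advance (suc k) e h T
        with symAt w (suc i) in a | symAt-just w (≤-trans (s≤s (m≤m+n i k)) (≤-reflexive (trans (sym (+-suc i k)) e)))
           | init-step {i = suc i} [] test home z≤n T
      ... | _ | _ , refl | R =
        R ▷ count-run k (increment bs) (trans (sym (+-suc i k)) e) h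

    reset-run : ∀ {b t i} l bs → length l + length bs ≤ b → TapeIs t (l ʳ++ digits bs) →
      Reaches (Within b) (to FQ (inj₁ reset)) i (length l) t
        (to FQ (inj₁ rewind)) i (moveWork M left (length l))
        (l ʳ++ map cell (replicate (length bs) c₀) ++ wall ∷ [])
    reset-run l [] h T = init-step l reset blank (m+n≤o⇒m≤o (length l) h) (pad-blank l T)
    reset-run {b} l (d ∷ bs) h T =
      init-step l reset (digit d) (m+n≤o⇒m≤o (length l) h) T ▷ λ T₁ →
      reset-run (cell c₀ ∷ l) bs (subst (_≤ b) (+-suc (length l) _) h) T₁ ▷ λ T₂ →
      init-step l rewind (cell c₀) (m+n≤o⇒m≤o (length l) h) T₂

    counter : List Bool
    counter = increments (suc (length w)) []

    width : ℕ
    width = length counter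

    init-run : Reaches (Within (suc width)) (to FQ (inj₁ begin)) 0 0 (λ _ → to FΓ blank)
      (to FQ (inj₂ (entry prog))) (suc (length w)) 0 (layout (replicate width c₀))
    init-run =
      init-step [] begin blank z≤n (mkTape λ { zero → refl ; (suc _) → refl }) ▷ λ T₁ →
      count-run (length w) [] refl ≤-refl T₁ ▷ λ T₂ →
      reset-run (home ∷ []) counter ≤-refl T₂ ▷ λ T₃ →
      init-step [] rewind home z≤n T₃

    width-upper : 2 ^ width ≤ 2 * suc (length w)
    width-upper = subst (λ v → 2 ^ width ≤ 2 * v)
      (trans (value-increments (suc (length w)) []) (+-identityʳ _))
      (topBitSet-value (increments-topBitSet (length w) top))

    -- Input positions run from 0 to `suc (length w)`, the right endmarker, so this says that a
    -- register can hold any of them.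
    width-lower : suc (length w) < 2 ^ width
    width-lower = subst (_< 2 ^ width)
      (trans (value-increments (suc (length w)) []) (+-identityʳ _)) (value< counter)

    bounded : ∀ t c → run M w t ≡ inj₁ c → workPos c ≤ 4 * (⌊log₂ length w ⌋ + 1)
    bounded t c e with init-run
    ... | reaches t′ T s =
      ≤-trans (steps-safe s (walled-safe W) t c (trans (sym (run-runFrom t)) e))
              (logBound (length w) width width-upper)
      where
      wall-nth : ∀ n → nth (map cell (replicate n c₀) ++ wall ∷ []) n ≡ wall
      wall-nth zero    = refl
      wall-nth (suc n) = wall-nth n
      W : Walled (suc width) (config (to FQ (inj₂ (entry prog))) (suc (length w)) 0 t′)
      W = record { control = entry prog ; state-is = refl ; before = z≤n
                 ; wall-at = trans (at T (suc width)) (cong (to FΓ) (wall-nth width)) }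

    relax : ∀ {P c c′} → Steps P c c′ → Steps Unconstrained c c′
    relax done         = done
    relax (next p e s) = next tt e (relax s)

    halts : ∀ {b cs i} → Exec w prog (replicate width c₀) (suc (length w)) b cs i →
            ∃ λ t → run M w t ≡ inj₂ b
    halts {b} {i = i} ex with init-run
    ... | reaches t₁ T₁ s₁ with Exec⇒Reaches (to FQ ∘ inj₂) prog-hosted ex T₁
    ... | reaches t₂ T₂ s₂ with runFrom-halts (relax s₁ ∙ s₂) (halting t₂)
      where
      halting : ∀ t → stepM M w (config (to FQ (inj₂ (inj₂ b))) i 0 t) ≡ inj₂ b
      halting t rewrite from-to FQ (inj₂ (inj₂ b)) = refl
    ... | t , e = t , trans (run-runFrom t) e

-- The space bound comes for free. What is left for a decision problem is a derivation on each
-- encoding, for any number of cells that can count up to the right endmarker.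
inL : {I : Set} {enc : I → List Sym} {Q : I → Set}
  (Cell : Set) (finiteCell : Finite Cell) (c₀ : Cell) (prog : Programs.Prog Cell Bool) →
  (∀ x width → suc (length (enc x)) < 2 ^ width → Σ Bool λ b →
    (∃₂ λ cs i → Programs.Exec Cell (enc x) prog (replicate width c₀) (suc (length (enc x))) b cs i) ×
    ((b ≡ true) ⇔ Q x)) →
  InL enc Q
inL {enc = enc} Cell finiteCell c₀ prog decides =
  machine , (4 , Input.bounded) , λ x →
    let open Input (enc x)
        b , (_ , _ , ex) , correct = decides x width width-lower
        t , halted                 = halts ex
    in t , b , halted , correct
  where open Machine Cell finiteCell c₀ prog

-- Registers and the stack

Reg : Set
Reg = Fin 8

module RegisterPrograms (A : ℕ) where

  Frame : Set
  Frame = Vec Bool A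

  -- Bit i of every register and frame i (from the top) of the stack share cell i.
  Cell : Set
  Cell = Vec Bool 8 × Frame

  finite-Cell : Finite Cell
  finite-Cell = finite-× (finite-Vec finite-Bool 8) (finite-Vec finite-Bool A)

  emptyFrame : Frame
  emptyFrame = Vec.replicate A false

  emptyCell : Cell
  emptyCell = Vec.replicate 8 false , emptyFrame

  open Programs Cell public

  keep : {Z : Set} → Z → Cell → Z × Cell
  keep s c = s , c

  onReg : {Z : Set} → Reg → (Z → Vec Bool 8 → Z × Bool) → Z → Cell → Z × Cell
  onReg r f s (bs , fr) = proj₁ (f s bs) , bs [ r ]≔ proj₂ (f s bs) , fr

  -- Half adder and half subtractor. The sweep state is the carry or borrow, so starting with `true`
  -- adds or subtracts one.
  addBit subBit : Reg → Bool → Vec Bool 8 → Bool × Bool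
  addBit r c bs = c ∧ lookup bs r , c xor lookup bs r
  subBit r c bs = c ∧ not (lookup bs r) , c xor lookup bs r

  -- A more significant difference overrides the less significant ones.
  compareBits : Reg → Reg → Bool → Vec Bool 8 → Bool
  compareBits r s st bs = if lookup bs r xor lookup bs s then lookup bs s else st

  -- The sweep holds one frame and swaps it with that of each cell. Done on the way out this moves
  -- the stack one cell away from home, which is a push; done on the way back it moves the stack
  -- towards home and ends up holding the top, which is a pop.
  shift : Frame → Cell → Frame × Cell
  shift f (bs , f′) = f′ , bs , f

  inc dec : Reg → Prog ⊤
  inc r = sweep finite-Bool (onReg r (addBit r)) keep true (λ _ → ret tt)
  dec r = sweep finite-Bool (onReg r (subBit r)) keep true (λ _ → ret tt)

  copy : Reg → Reg → Prog ⊤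
  copy s r = sweep finite-⊤ (onReg r (λ _ bs → tt , lookup bs s)) keep tt ret

  lt : Reg → Reg → Prog Bool
  lt r s = sweep finite-Bool (λ st c → compareBits r s st (proj₁ c) , c) keep false ret

  push : Frame → Prog ⊤
  push f = sweep (finite-Vec finite-Bool A) shift keep f (λ _ → ret tt)

  pop : Prog Frame
  pop = sweep (finite-Vec finite-Bool A) keep shift emptyFrame ret

  scan : {Z : Set} → (Z → Cell → Z × Cell) → Z → List Cell → Z × List Cell
  scan f s []       = s , []
  scan f s (c ∷ cs) = proj₁ (scan f (proj₁ (f s c)) cs) , proj₂ (f s c) ∷ proj₂ (scan f (proj₁ (f s c)) cs)

  pass-scan : ∀ {Z} (f : Z → Cell → Z × Cell) s cs acc →
              pass f s cs acc ≡ (proj₁ (scan f s cs) , proj₂ (scan f s cs) ʳ++ acc)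
  pass-scan f s []       acc = refl
  pass-scan f s (c ∷ cs) acc = pass-scan f (proj₁ (f s c)) cs _

  pass-keep : ∀ {Z} (s : Z) cs acc → pass keep s cs acc ≡ (s , cs ʳ++ acc)
  pass-keep s []       acc = refl
  pass-keep s (c ∷ cs) acc = pass-keep s cs (c ∷ acc)

  ʳ++-involutive : ∀ {B : Set} (xs : List B) → (xs ʳ++ []) ʳ++ [] ≡ xs
  ʳ++-involutive xs = trans (ʳ++-ʳ++ xs) (++-identityʳ xs)

  frames : List Cell → List Frame
  frames = map proj₂

  pass-shift : ∀ f cs acc →
    proj₁ (pass shift f cs acc) ∷ frames (proj₂ (pass shift f cs acc)) ≡ frames cs ʳ++ f ∷ frames acc
  pass-shift f []       acc = refl
  pass-shift f (c ∷ cs) acc = pass-shift (proj₂ c) cs _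

  length-pass : ∀ {Z} (f : Z → Cell → Z × Cell) s cs acc →
                length (proj₂ (pass f s cs acc)) ≡ length cs + length acc
  length-pass f s []       acc = refl
  length-pass f s (c ∷ cs) acc = trans (length-pass f _ cs _) (+-suc (length cs) (length acc))

  track : Reg → List Cell → List Bool
  track r = map (λ c → lookup (proj₁ c) r)

  pass-shift-track : ∀ r f cs acc → track r (proj₂ (pass shift f cs acc)) ≡ track r cs ʳ++ track r acc
  pass-shift-track r f []       acc = refl
  pass-shift-track r f (c ∷ cs) acc = pass-shift-track r (proj₂ c) cs _

  scan-length : ∀ {Z} (f : Z → Cell → Z × Cell) s cs → length (proj₂ (scan f s cs)) ≡ length cs
  scan-length f s []       = refl
  scan-length f s (c ∷ cs) = cong suc (scan-length f _ cs)

  scan-frames : ∀ {Z} r f (s : Z) cs → frames (proj₂ (scan (onReg r f) s cs)) ≡ frames cs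
  scan-frames r f s []       = refl
  scan-frames r f s (c ∷ cs) = cong (proj₂ c ∷_) (scan-frames r f _ cs)

  scan-other : ∀ {Z} r f (s : Z) cs {r′} → r′ ≢ r → track r′ (proj₂ (scan (onReg r f) s cs)) ≡ track r′ cs
  scan-other r f s []       ne = refl
  scan-other r f s (c ∷ cs) {r′} ne =
    cong₂ _∷_ (lookup∘updateAt′ r′ r ne (proj₁ c)) (scan-other r f _ cs ne)

  open +-*-Solver

  -- An exact identity, in which the outgoing carry stands for a digit beyond the last cell.
  -- Overflow is excluded only later, in `does-inc`.
  scan-add : ∀ r c cs →
    let s = scan (onReg r (addBit r)) c cs in
    value (track r (proj₂ s)) + 2 ^ length cs * bit (proj₁ s) ≡ value (track r cs) + bit c
  scan-add r c []       = +-identityʳ (bit c)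
  scan-add r c (x ∷ cs) rewrite lookup∘updateAt r {f = λ _ → c xor lookup (proj₁ x) r} (proj₁ x) =
    begin
      bit (c xor b) + 2 * v′ + 2 * pw * o
        ≡⟨ solve 4 (λ a v p o → a :+ con 2 :* v :+ con 2 :* p :* o := a :+ con 2 :* (v :+ p :* o)) refl
             (bit (c xor b)) v′ pw o ⟩
      bit (c xor b) + 2 * (v′ + pw * o)
        ≡⟨ cong (λ z → bit (c xor b) + 2 * z) (scan-add r (c ∧ b) cs) ⟩
      bit (c xor b) + 2 * (v + bit (c ∧ b))
        ≡⟨ solve 3 (λ a v k → a :+ con 2 :* (v :+ k) := a :+ con 2 :* k :+ con 2 :* v) refl
             (bit (c xor b)) v (bit (c ∧ b)) ⟩
      bit (c xor b) + 2 * bit (c ∧ b) + 2 * v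
        ≡⟨ cong (_+ 2 * v) (digit-sum c b) ⟩
      bit b + bit c + 2 * v
        ≡⟨ solve 3 (λ b c v → b :+ c :+ con 2 :* v := b :+ con 2 :* v :+ c) refl (bit b) (bit c) v ⟩
      bit b + 2 * v + bit c ∎
    where
    open ≡-Reasoning
    b = lookup (proj₁ x) r
    s = scan (onReg r (addBit r)) (c ∧ b) cs
    v = value (track r cs)
    v′ = value (track r (proj₂ s))
    pw = 2 ^ length cs
    o = bit (proj₁ s)
    digit-sum : ∀ c b → bit (c xor b) + 2 * bit (c ∧ b) ≡ bit b + bit c
    digit-sum false false = refl
    digit-sum false true  = refl
    digit-sum true  false = refl
    digit-sum true  true  = refl

  scan-sub : ∀ r c cs →
    let s = scan (onReg r (subBit r)) c cs in
    value (track r (proj₂ s)) + bit c ≡ value (track r cs) + 2 ^ length cs * bit (proj₁ s)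
  scan-sub r c []       = sym (+-identityʳ (bit c))
  scan-sub r c (x ∷ cs) rewrite lookup∘updateAt r {f = λ _ → c xor lookup (proj₁ x) r} (proj₁ x) =
    begin
      bit (c xor b) + 2 * v′ + bit c
        ≡⟨ solve 3 (λ a v c → a :+ con 2 :* v :+ c := a :+ c :+ con 2 :* v) refl (bit (c xor b)) v′ (bit c) ⟩
      bit (c xor b) + bit c + 2 * v′
        ≡⟨ cong (_+ 2 * v′) (digit-sub c b) ⟩
      bit b + 2 * bit (c ∧ not b) + 2 * v′
        ≡⟨ solve 3 (λ b k v → b :+ con 2 :* k :+ con 2 :* v := b :+ con 2 :* (v :+ k)) refl
             (bit b) (bit (c ∧ not b)) v′ ⟩
      bit b + 2 * (v′ + bit (c ∧ not b))
        ≡⟨ cong (λ z → bit b + 2 * z) (scan-sub r (c ∧ not b) cs) ⟩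
      bit b + 2 * (v + pw * o)
        ≡⟨ solve 4 (λ b v p o → b :+ con 2 :* (v :+ p :* o) := b :+ con 2 :* v :+ con 2 :* p :* o) refl
             (bit b) v pw o ⟩
      bit b + 2 * v + 2 * pw * o ∎
    where
    open ≡-Reasoning
    b = lookup (proj₁ x) r
    s = scan (onReg r (subBit r)) (c ∧ not b) cs
    v = value (track r cs)
    v′ = value (track r (proj₂ s))
    pw = 2 ^ length cs
    o = bit (proj₁ s)
    digit-sub : ∀ c b → bit (c xor b) + bit c ≡ bit b + 2 * bit (c ∧ not b)
    digit-sub false false = refl
    digit-sub false true  = refl
    digit-sub true  false = refl
    digit-sub true  true  = refl

  scan-copy : ∀ r s cs → track r (proj₂ (scan (onReg r (λ _ bs → tt , lookup bs s)) tt cs)) ≡ track s cs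
  scan-copy r s []       = refl
  scan-copy r s (c ∷ cs) = cong₂ _∷_ (lookup∘updateAt r (proj₁ c)) (scan-copy r s cs)

  compare-scan : Reg → Reg → Bool → List Cell → Bool × List Cell
  compare-scan r s = scan (λ st c → compareBits r s st (proj₁ c) , c)

  compare-scan-cells : ∀ r s st cs → proj₂ (compare-scan r s st cs) ≡ cs
  compare-scan-cells r s st []       = refl
  compare-scan-cells r s st (c ∷ cs) = cong (c ∷_) (compare-scan-cells r s _ cs)

  double-<ᵇ : ∀ m n → (2 * m <ᵇ 2 * n) ≡ (m <ᵇ n)
  double-<ᵇ zero    zero    = refl
  double-<ᵇ zero    (suc n) = refl
  double-<ᵇ (suc m) zero    = refl
  double-<ᵇ (suc m) (suc n) rewrite +-suc m (m + 0) | +-suc n (n + 0) = double-<ᵇ m n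

  double-<ᵇ-suc : ∀ m n → (2 * m <ᵇ suc (2 * n)) ≡ (m <ᵇ suc n)
  double-<ᵇ-suc zero    n       = refl
  double-<ᵇ-suc (suc m) zero    = refl
  double-<ᵇ-suc (suc m) (suc n) rewrite +-suc m (m + 0) | +-suc n (n + 0) = double-<ᵇ-suc m n

  suc-double-<ᵇ : ∀ m n → (suc (2 * m) <ᵇ 2 * n) ≡ (m <ᵇ n)
  suc-double-<ᵇ zero    zero    = refl
  suc-double-<ᵇ zero    (suc n) rewrite +-suc n (n + 0) = refl
  suc-double-<ᵇ (suc m) zero    = refl
  suc-double-<ᵇ (suc m) (suc n) rewrite +-suc m (m + 0) | +-suc n (n + 0) = suc-double-<ᵇ m n

  compare-step : ∀ x y st m n →
    (bit x + 2 * m <ᵇ bit st + (bit y + 2 * n)) ≡ (m <ᵇ bit (if x xor y then y else st) + n)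
  compare-step false false false m n = double-<ᵇ m n
  compare-step false false true  m n = double-<ᵇ-suc m n
  compare-step false true  false m n = double-<ᵇ-suc m n
  compare-step false true  true  m n =
    trans (cong (2 * m <ᵇ_) (sym (*-suc 2 n))) (double-<ᵇ m (suc n))
  compare-step true  false false m n = suc-double-<ᵇ m n
  compare-step true  false true  m n = double-<ᵇ m n
  compare-step true  true  false m n = double-<ᵇ m n
  compare-step true  true  true  m n = double-<ᵇ-suc m n

  -- The incoming state is the verdict on the lower digits and decides a tie among the remaining
  -- ones: as a summand, `bit st` turns the strict comparison into a weak one when `st` is `true`.
  compare-scan-result : ∀ r s st cs →
    proj₁ (compare-scan r s st cs) ≡ (value (track r cs) <ᵇ bit st + value (track s cs))
  compare-scan-result r s false []    = refl
  compare-scan-result r s true  []    = refl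
  compare-scan-result r s st (c ∷ cs) = trans (compare-scan-result r s _ cs)
    (sym (compare-step (lookup (proj₁ c) r) (lookup (proj₁ c) s) st (value (track r cs)) (value (track s cs))))

  iterate : {Z Y : Set} → Finite Z → Finite Y → (Z → Prog (Z ⊎ Y)) → Z → Prog Y
  iterate F G f s = loop F G f s ret

  record State : Set where
    constructor ⟨_,_,_⟩
    field
      regs  : Vec ℕ 8
      stack : List Frame
      head  : ℕ

  open State public

  -- With `width` work cells, registers hold the numbers below 2 ^ width.
  module Semantics (w : List Sym) (width : ℕ) (large : suc (length w) < 2 ^ width) where

    -- Each of the cells holds a frame, but only the first few form the stack. Those in `rest` are
    -- arbitrary, so a push may drop the last of them.
    record Rep (cs : List Cell) (ρ : Vec ℕ 8) (stk : List Frame) : Set where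
      field
        cells  : length cs ≡ width
        values : ∀ r → value (track r cs) ≡ lookup ρ r
        rest   : List Frame
        stacks : frames cs ≡ stk ++ rest

    open Rep

    infix 0 _⊨_⇓_,_

    -- A total correctness triple on abstract states. It quantifies over all cell contents that
    -- represent the initial state, because the frames below the stack are left open.
    record _⊨_⇓_,_ {X : Set} (p : Prog X) (σ : State) (x : X) (σ′ : State) : Set₁ where
      constructor does
      field
        perform : ∀ {cs} → Rep cs (regs σ) (stack σ) →
                Σ (List Cell) λ cs′ → Rep cs′ (regs σ′) (stack σ′) × Exec w p cs (head σ) x cs′ (head σ′)

    open _⊨_⇓_,_ public

    infixr 2 _►_

    _►_ : ∀ {X Y} {p : Prog X} {g : X → Prog Y} {σ x σ₁ y σ₂} →
          p ⊨ σ ⇓ x , σ₁ → g x ⊨ σ₁ ⇓ y , σ₂ → p >>= g ⊨ σ ⇓ y , σ₂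
    d ► d′ = does λ C → let _ , R₁ , e = perform d C ; _ , R₂ , e′ = perform d′ R₁ in
                          _ , R₂ , exec-bind e e′

    pure : ∀ {X} {x : X} {σ} → ret x ⊨ σ ⇓ x , σ
    pure = does λ C → _ , C , ret

    again : ∀ {Z Y} {F : Finite Z} {G : Finite Y} {f s s₁ σ σ₁ y σ₂} →
            f s ⊨ σ ⇓ inj₁ s₁ , σ₁ → iterate F G f s₁ ⊨ σ₁ ⇓ y , σ₂ → iterate F G f s ⊨ σ ⇓ y , σ₂
    perform (again d d′) C with perform d C
    ... | _ , R₁ , e with perform d′ R₁
    ... | _ , R₂ , e′ = _ , R₂ , loop-more e e′

    leave : ∀ {Z Y} {F : Finite Z} {G : Finite Y} {f s σ y σ₁} →
            f s ⊨ σ ⇓ inj₂ y , σ₁ → iterate F G f s ⊨ σ ⇓ y , σ₁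
    perform (leave d) C with perform d C
    ... | _ , R₁ , e = _ , R₁ , loop-done e ret

    sweep-scan : ∀ {X Z} {F : Finite Z} {f : Z → Cell → Z × Cell} {s} {k : Z → Prog X} {cs i x cs′ i′} →
      Exec w (k (proj₁ (scan f s cs))) (proj₂ (scan f s cs)) i x cs′ i′ →
      Exec w (sweep F f keep s k) cs i x cs′ i′
    sweep-scan {f = f} {s} {cs = cs} e = sweep (pass-scan f s cs [])
      (trans (pass-keep (proj₁ (scan f s cs)) (proj₂ (scan f s cs) ʳ++ []) [])
             (cong (proj₁ (scan f s cs) ,_) (ʳ++-involutive (proj₂ (scan f s cs))))) e

    rep-update : ∀ {Z cs ρ stk v} r f (s : Z) → Rep cs ρ stk →
      value (track r (proj₂ (scan (onReg r f) s cs))) ≡ v →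
      Rep (proj₂ (scan (onReg r f) s cs)) (ρ [ r ]≔ v) stk
    cells  (rep-update {cs = cs} r f s C e) = trans (scan-length (onReg r f) s cs) (cells C)
    values (rep-update {cs = cs} {ρ} r f s C e) r′ with r′ Fin.≟ r
    ... | yes refl = trans e (sym (lookup∘updateAt r ρ))
    ... | no ne    = trans (cong value (scan-other r f s cs ne))
                           (trans (values C r′) (sym (lookup∘updateAt′ r′ r ne ρ)))
    rest   (rep-update r f s C e) = rest C
    stacks (rep-update {cs = cs} r f s C e) = trans (scan-frames r f s cs) (stacks C)

    does-inc : ∀ r {ρ stk i} → lookup ρ r ≤ length w →
               inc r ⊨ ⟨ ρ , stk , i ⟩ ⇓ tt , ⟨ ρ [ r ]≔ suc (lookup ρ r) , stk , i ⟩
    perform (does-inc r {ρ} h) {cs} C = _ , rep-update r (addBit r) true C result , sweep-scan ret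
      where
      s = scan (onReg r (addBit r)) true cs
      v′ = value (track r (proj₂ s))
      total′ : v′ + 2 ^ length cs * bit (proj₁ s) ≡ suc (lookup ρ r)
      total′ = trans (scan-add r true cs) (trans (+-comm _ 1) (cong suc (values C r)))
      result : v′ ≡ suc (lookup ρ r)
      result with proj₁ s | total′
      ... | false | t = trans (sym (trans (cong (v′ +_) (*-zeroʳ (2 ^ length cs))) (+-identityʳ v′))) t
      -- A carry out of the last cell would make the successor at least `2 ^ width`, which `large`
      -- forbids.
      ... | true  | t = ⊥-elim (<⇒≱ (≤-trans (s≤s (s≤s h)) large)
              (subst (2 ^ width ≤_) t (≤-trans (≤-reflexive
                (trans (cong (2 ^_) (sym (cells C))) (sym (*-identityʳ _)))) (m≤n+m _ v′))))

    does-dec : ∀ r {ρ stk i m} → lookup ρ r ≡ suc m →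
               dec r ⊨ ⟨ ρ , stk , i ⟩ ⇓ tt , ⟨ ρ [ r ]≔ m , stk , i ⟩
    perform (does-dec r {ρ} {m = m} h) {cs} C = _ , rep-update r (subBit r) true C result , sweep-scan ret
      where
      s = scan (onReg r (subBit r)) true cs
      v′ = value (track r (proj₂ s))
      total′ : v′ + 1 ≡ suc m + 2 ^ length cs * bit (proj₁ s)
      total′ = trans (scan-sub r true cs) (cong (_+ 2 ^ length cs * bit (proj₁ s)) (trans (values C r) h))
      result : v′ ≡ m
      result with proj₁ s | total′
      ... | false | t = suc-injective (trans (+-comm 1 v′) (trans t
              (trans (cong (suc m +_) (*-zeroʳ (2 ^ length cs))) (+-identityʳ (suc m)))))
      -- A borrow out of the last cell would make `v′` at least `2 ^ length cs`, too much for that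
      -- many bits.
      ... | true  | t = ⊥-elim (<⇒≱
              (subst (v′ <_) (cong (2 ^_) (trans (length-map _ (proj₂ s)) (scan-length _ true cs))) (value< (track r (proj₂ s))))
              (≤-pred (subst (suc (2 ^ length cs) ≤_) (trans (sym t) (+-comm v′ 1))
                (s≤s (≤-trans (≤-reflexive (sym (*-identityʳ _))) (m≤n+m _ m))))))

    does-copy : ∀ s r {ρ stk i} → copy s r ⊨ ⟨ ρ , stk , i ⟩ ⇓ tt , ⟨ ρ [ r ]≔ lookup ρ s , stk , i ⟩
    perform (does-copy s r) {cs} C =
      _ , rep-update r _ tt C (trans (cong value (scan-copy r s cs)) (values C s)) , sweep-scan ret

    does-lt : ∀ r s {ρ stk i} → lt r s ⊨ ⟨ ρ , stk , i ⟩ ⇓ lookup ρ r <ᵇ lookup ρ s , ⟨ ρ , stk , i ⟩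
    perform (does-lt r s {ρ} {i = i}) {cs} C = cs , C , sweep-scan
      (subst₂ (λ b cs′ → Exec w (ret (proj₁ (compare-scan r s false cs))) (proj₂ (compare-scan r s false cs)) i b cs′ i)
        (trans (compare-scan-result r s false cs) (cong₂ _<ᵇ_ (values C r) (values C s)))
        (compare-scan-cells r s false cs) ret)

    -- For `does-push`: the frame that falls off the far end is `y`. If the new stack `zs` is no
    -- longer than the list of cells, it survives intact.
    prefix-of-init : ∀ {B : Set} (zs : List B) {xs y ys} → zs ++ ys ≡ xs ++ y ∷ [] →
                     length zs ≤ length xs → ∃ λ ys′ → xs ≡ zs ++ ys′
    prefix-of-init []       e h = _ , refl
    prefix-of-init (z ∷ zs) {x ∷ xs} e (s≤s h)
      with prefix-of-init zs {xs} (∷-injectiveʳ e) h | ∷-injectiveˡ e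
    ... | ys′ , refl | refl = ys′ , refl

    does-push : ∀ f {ρ stk i} → suc (length stk) ≤ width →
                push f ⊨ ⟨ ρ , stk , i ⟩ ⇓ tt , ⟨ ρ , f ∷ stk , i ⟩
    perform (does-push f {ρ} {stk} h) {cs} C = r ʳ++ [] , rep , sweep refl (pass-keep _ r []) ret
      where
      out = pass shift f cs []
      r = proj₂ out
      len : length (r ʳ++ []) ≡ width
      len = trans (length-ʳ++ r) (trans (+-identityʳ _) (trans (length-pass shift f cs [])
              (trans (+-identityʳ _) (cells C))))
      shifted : f ∷ stk ++ rest C ≡ frames (r ʳ++ []) ++ proj₁ out ∷ []
      shifted = begin
        f ∷ stk ++ rest C                          ≡⟨ cong (f ∷_) (sym (stacks C)) ⟩
        f ∷ frames cs                              ≡⟨ cong (f ∷_) (sym (++-identityʳ _)) ⟩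
        f ∷ frames cs ++ []                        ≡⟨ sym (ʳ++-ʳ++ (frames cs)) ⟩
        (frames cs ʳ++ f ∷ []) ʳ++ []              ≡⟨ cong (_ʳ++ []) (sym (pass-shift f cs [])) ⟩
        (proj₁ out ∷ frames r) ʳ++ []                ≡⟨⟩
        frames r ʳ++ proj₁ out ∷ []                  ≡⟨ ʳ++-defn (frames r) ⟩
        _                                          ≡⟨ cong (_++ proj₁ out ∷ []) (sym (trans (map-ʳ++ proj₂ r) (trans (ʳ++-defn (frames r)) (++-identityʳ _)))) ⟩
        frames (r ʳ++ []) ++ proj₁ out ∷ []          ∎
        where open ≡-Reasoning
      split : ∃ λ ys → frames (r ʳ++ []) ≡ (f ∷ stk) ++ ys
      split = prefix-of-init (f ∷ stk) shifted
                (subst (suc (length stk) ≤_) (sym (trans (length-map proj₂ (r ʳ++ [])) len)) h)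
      rep : Rep (r ʳ++ []) ρ (f ∷ stk)
      rep = record
        { cells  = len
        ; values = λ q → trans (cong value (trans (map-ʳ++ _ r)
                     (trans (cong (_ʳ++ []) (pass-shift-track q f cs [])) (ʳ++-involutive (track q cs)))))
                     (values C q)
        ; rest   = proj₁ split
        ; stacks = proj₂ split
        }

    does-pop : ∀ {f ρ stk i} → pop ⊨ ⟨ ρ , f ∷ stk , i ⟩ ⇓ f , ⟨ ρ , stk , i ⟩
    perform (does-pop {f} {ρ} {stk}) {cs} C =
      r , rep , sweep (pass-keep emptyFrame cs []) refl
        (subst (λ g → Exec w (ret g) r _ f r _) (sym (∷-injectiveˡ shifted)) ret)
      where
      out = pass shift emptyFrame (cs ʳ++ []) []
      r = proj₂ out
      shifted : proj₁ out ∷ frames r ≡ f ∷ stk ++ rest C ++ emptyFrame ∷ []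
      shifted = begin
        proj₁ out ∷ frames r                       ≡⟨ pass-shift emptyFrame (cs ʳ++ []) [] ⟩
        frames (cs ʳ++ []) ʳ++ emptyFrame ∷ []     ≡⟨ cong (_ʳ++ emptyFrame ∷ []) (map-ʳ++ proj₂ cs) ⟩
        (frames cs ʳ++ []) ʳ++ emptyFrame ∷ []     ≡⟨ ʳ++-ʳ++ (frames cs) ⟩
        frames cs ++ emptyFrame ∷ []               ≡⟨ cong (_++ emptyFrame ∷ []) (stacks C) ⟩
        (f ∷ stk ++ rest C) ++ emptyFrame ∷ []     ≡⟨ cong (f ∷_) (++-assoc stk (rest C) _) ⟩
        f ∷ stk ++ rest C ++ emptyFrame ∷ []       ∎
        where open ≡-Reasoning
      rep : Rep r ρ stk
      rep = record
        { cells  = trans (length-pass shift emptyFrame (cs ʳ++ []) [])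
                     (trans (+-identityʳ _) (trans (length-ʳ++ cs) (trans (+-identityʳ _) (cells C))))
        ; values = λ q → trans (cong value (trans (pass-shift-track q emptyFrame (cs ʳ++ []) [])
                     (trans (cong (_ʳ++ []) (map-ʳ++ _ cs)) (ʳ++-involutive (track q cs)))))
                     (values C q)
        ; rest   = rest C ++ emptyFrame ∷ []
        ; stacks = ∷-injectiveʳ shifted
        }

-- Reading the input

-- rZ always holds 0, rT is scratch space for readAt, rV points to the current
-- token and rX is the scanning pointer.
pattern rZ = zero
pattern rT = suc zero
pattern rV = suc (suc zero)
pattern rC = suc (suc (suc zero))
pattern rD = suc (suc (suc (suc zero)))
pattern rX = suc (suc (suc (suc (suc zero))))
pattern rN = suc (suc (suc (suc (suc (suc zero)))))
pattern rM = suc (suc (suc (suc (suc (suc (suc zero))))))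

data Token : Set where
  leaf  : Token
  node  : (n : ℕ) → (Vec Bool n → Bool) → Token
  other : Token

decode : List Sym → ℕ
decode (𝟎 ∷ ds) = 2 * suc (decode ds)
decode (𝟏 ∷ ds) = suc (2 * decode ds)
decode _        = 0

decode-encBin : ∀ m → decode (encBin m) ≡ Bin.toℕ m
decode-encBin Bin.zero = refl
decode-encBin 2[1+ m ] = cong (λ z → 2 * suc z) (decode-encBin m)
decode-encBin 1+[2 m ] = cong (λ z → suc (2 * z)) (decode-encBin m)

length-encBin : ∀ m → length (encBin m) ≤ Bin.toℕ m
length-encBin Bin.zero = z≤n
length-encBin 2[1+ m ] = ≤-trans (s≤s (length-encBin m)) (m≤m+n (suc (Bin.toℕ m)) _)
length-encBin 1+[2 m ] = s≤s (≤-trans (length-encBin m) (m≤m+n (Bin.toℕ m) _))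

functionAt : List BoolFun → ℕ → Token
functionAt []            _       = other
functionAt ((n , f) ∷ B) zero    = node n f
functionAt (_ ∷ B)       (suc i) = functionAt B i

functionAt-toℕ : ∀ B i → functionAt B (toℕ i) ≡ node (arity B i) (fun B i)
functionAt-toℕ (_ ∷ B) zero    = refl
functionAt-toℕ (_ ∷ B) (suc i) = functionAt-toℕ B i

secondArgument : Vec Bool 2 → Bool
secondArgument (_ ∷ b ∷ []) = b

-- Frames of one fixed width have to serve all arities; the sum is a convenient upper bound, and the
-- 2 accounts for `S`.
frameWidth : List BoolFun → ℕ
frameWidth = foldr (λ f a → proj₁ f + a) 2

module Navigation (B : List BoolFun) where
  open RegisterPrograms (frameWidth B) public

  continue : {Y : Set} → Prog (⊤ ⊎ Y)
  continue = ret (inj₁ tt)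

  stop : {Y : Set} → Y → Prog (⊤ ⊎ Y)
  stop y = ret (inj₂ y)

  repeat : {Y : Set} → Finite Y → Prog (⊤ ⊎ Y) → Prog Y
  repeat G body = iterate finite-⊤ G (λ _ → body) tt

  clear : Reg → Prog ⊤
  clear r = copy rZ r

  seekT rewindHead : Prog ⊤
  seekT = repeat finite-⊤ (lt rZ rT >>= λ b →
    if b then (dec rT >> move right continue) else stop tt)
  rewindHead = repeat finite-⊤ (read λ { nothing → stop tt ; (just _) → move left continue })

  -- Between operations the input head rests at position 0. The position read may be the right
  -- endmarker, which `rewindHead` would mistake for the left one; hence the move to the left before
  -- it.
  readAt : Reg → Prog (Maybe Sym)
  readAt r = copy r rT >> seekT >> (read λ a → move left (rewindHead >> ret a))

  digitsFrom : ℕ → Maybe Sym → Prog (List Sym)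
  -- Unrolled instead of looping, so that the digits stay in the control. The index of a function in
  -- `B` has at most `length B` digits, a constant.
  digits : ℕ → Prog (List Sym)
  digits zero    = ret []
  digits (suc k) = inc rD >> (readAt rD >>= digitsFrom k)
  digitsFrom k (just 𝟎) = digits k >>= λ ds → ret (𝟎 ∷ ds)
  digitsFrom k (just 𝟏) = digits k >>= λ ds → ret (𝟏 ∷ ds)
  digitsFrom k _        = ret []

  tokenFrom : Maybe Sym → Prog Token
  tokenFrom (just tV) = ret leaf
  tokenFrom (just tS) = ret (node 2 secondArgument)
  tokenFrom (just tF) = copy rX rD >> (digits (length B) >>= λ ds →
                        clear rD >> ret (functionAt B (decode ds)))
  tokenFrom _         = ret other

  tokenX : Prog Token
  tokenX = readAt rX >>= tokenFrom

  skipNumeral-next : Maybe Sym → Prog (⊤ ⊎ ⊤)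
  skipNumeral-next (just ♯) = stop tt
  skipNumeral-next _        = continue

  skipNumeral : Prog ⊤
  skipNumeral = repeat finite-⊤ (readAt rX >>= λ a → inc rX >> skipNumeral-next a)

  eatFrom : Maybe Sym → Prog ⊤
  eatFrom (just tS) = inc rX
  eatFrom _         = inc rX >> skipNumeral

  eatToken : Prog ⊤
  eatToken = readAt rX >>= eatFrom

  addC : ℕ → Prog ⊤
  addC zero    = ret tt
  addC (suc n) = addC n >> inc rC

  expect : Token → Prog ⊤
  expect (node n _) = addC n
  expect _          = ret tt

  -- rC is the number of subformulae still to be skipped, rN counts their tokens.
  skip : Prog ⊤
  skip = repeat finite-⊤ (lt rZ rC >>= λ b →
    if b then (tokenX >>= λ t → eatToken >> dec rC >> inc rN >> expect t >> continue)
         else stop tt)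

  -- The index of the best child so far is kept in the control, as arities are bounded; only its
  -- size needs a register, `rM`.
  heavierFrom : ℕ → ℕ → ℕ → Prog ℕ
  heavierFrom j zero    h = ret h
  heavierFrom j (suc k) h =
    inc rC >> skip >> (lt rM rN >>= λ b →
    (if b then copy rN rM else ret tt) >> clear rN >>
    heavierFrom (suc j) k (if b then j else h))

  heavyChild : ℕ → Prog ℕ
  heavyChild n = copy rV rX >> eatToken >> (heavierFrom 0 n 0 >>= λ h →
    clear rM >> clear rX >> ret h)

  goChild : ℕ → Prog ⊤
  goChild i = copy rV rX >> eatToken >> addC i >> skip >> copy rX rV >> clear rX >> clear rN

  -- Transfers `rN` into the control when it is less than the given constant. Otherwise `rN` is left
  -- with the excess, which is just what `absorb` uses.
  below : ℕ → Prog (Maybe ℕ)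
  below zero    = ret nothing
  below (suc k) = lt rZ rN >>= λ b →
    if b then (dec rN >> (below k >>= λ r → ret (Maybe.map suc r))) else ret (just 0)

  tokenV : Prog Token
  tokenV = copy rV rX >> (tokenX >>= λ t → clear rX >> ret t)

  absorb : Maybe ℕ → Prog (⊤ ⊎ Bool)
  absorb (just _) = stop true
  -- The token takes its arguments from the complete subformulae and forms one new complete
  -- subformula with them.
  absorb nothing  = copy rN rC >> clear rN >> inc rC >> continue

  climb : Token → Prog (⊤ ⊎ Bool)
  climb leaf       = inc rC >> continue
  climb (node n _) = copy rC rN >> (below n >>= absorb)
  climb other      = continue

  climbFrom : Maybe Sym → Prog (⊤ ⊎ Bool)
  climbFrom nothing  = stop false
  climbFrom (just _) = tokenV >>= climb

  -- Scanning leftwards, rC counts the complete subformulae between the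
  -- current token and the starting point: a token with more arguments than
  -- that is the parent, and rC is then the index of the child.
  parent : Prog Bool
  parent = repeat finite-Bool (dec rV >> (readAt rV >>= climbFrom))

  module Positions (w : List Sym) (width : ℕ) (large : suc (length w) < 2 ^ width) where
    open Semantics w width large public

    σ : (v c d x n m : ℕ) → List Frame → State
    σ v c d x n m stk = ⟨ 0 ∷ 0 ∷ v ∷ c ∷ d ∷ x ∷ n ∷ m ∷ [] , stk , 0 ⟩

    does-move : ∀ {X} m {k : Prog X} {ρ stk i y σ′} → k ⊨ ⟨ ρ , stk , headMove (length w) m i ⟩ ⇓ y , σ′ →
                move m k ⊨ ⟨ ρ , stk , i ⟩ ⇓ y , σ′
    does-move m d = does λ r → let _ , r′ , e = perform d r in _ , r′ , move e

    does-read : ∀ {X} {k : Maybe Sym → Prog X} {ρ stk i a y σ′} → symAt w i ≡ a →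
                k a ⊨ ⟨ ρ , stk , i ⟩ ⇓ y , σ′ → read k ⊨ ⟨ ρ , stk , i ⟩ ⇓ y , σ′
    does-read refl d = does λ r → let _ , r′ , e = perform d r in _ , r′ , read e

    does-seekT : ∀ k {ρ stk} i → k + i ≤ suc (length w) →
                 seekT ⊨ ⟨ 0 ∷ k ∷ ρ , stk , i ⟩ ⇓ tt , ⟨ 0 ∷ 0 ∷ ρ , stk , k + i ⟩
    does-seekT zero    i h = leave (does-lt rZ rT ► pure)
    does-seekT (suc k) {ρ} {stk} i h = again
      (does-lt rZ rT ► does-dec rT refl ► does-move right
        (subst (λ j → continue {⊤} ⊨ ⟨ 0 ∷ k ∷ ρ , stk , j ⟩ ⇓ inj₁ tt , ⟨ 0 ∷ k ∷ ρ , stk , suc i ⟩)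
               (sym (m≤n⇒m⊓n≡m (≤-trans (s≤s (m≤n+m i k)) h))) pure))
      (subst (λ j → seekT ⊨ ⟨ 0 ∷ k ∷ ρ , stk , suc i ⟩ ⇓ tt , ⟨ 0 ∷ 0 ∷ ρ , stk , j ⟩) (+-suc k i)
             (does-seekT k (suc i) (subst (_≤ suc (length w)) (sym (+-suc k i)) h)))

    does-rewind : ∀ i {ρ stk} → i ≤ length w →
                  rewindHead ⊨ ⟨ ρ , stk , i ⟩ ⇓ tt , ⟨ ρ , stk , 0 ⟩
    does-rewind zero    h = leave (does-read refl pure)
    does-rewind (suc i) h with symAt-just w h
    ... | a , e = again (does-read e (does-move left pure)) (does-rewind i (<⇒≤ h))

    does-readAt : ∀ r {ρ stk a} → lookup ρ r ≤ suc (length w) → symAt w (lookup ρ r) ≡ a →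
      readAt (suc (suc r)) ⊨ ⟨ 0 ∷ 0 ∷ ρ , stk , 0 ⟩ ⇓ a , ⟨ 0 ∷ 0 ∷ ρ , stk , 0 ⟩
    does-readAt r {ρ} {stk} h e =
      does-copy (suc (suc r)) rT ►
      subst (λ j → seekT ⊨ ⟨ 0 ∷ lookup ρ r ∷ ρ , stk , 0 ⟩ ⇓ tt , ⟨ 0 ∷ 0 ∷ ρ , stk , j ⟩) (+-identityʳ (lookup ρ r))
        (does-seekT (lookup ρ r) 0 (subst (_≤ suc (length w)) (sym (+-identityʳ _)) h)) ►
      does-read e (does-move left (does-rewind (pred (lookup ρ r)) (≤-pred′ h) ► pure))
      where
      ≤-pred′ : ∀ {m n} → m ≤ suc n → pred m ≤ n
      ≤-pred′ {zero}  h       = z≤n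
      ≤-pred′ {suc m} (s≤s h) = h

    symAt-just⇒≤ : ∀ v {i a} → symAt v i ≡ just a → i ≤ length v
    symAt-just⇒≤ (_ ∷ v) {suc zero}    e = s≤s z≤n
    symAt-just⇒≤ (_ ∷ v) {suc (suc i)} e = s≤s (symAt-just⇒≤ v {suc i} e)

    -- The input has the symbols ls at positions x, …, y - 1.
    data Span (x : ℕ) : List Sym → ℕ → Set where
      []  : x ≤ suc (length w) → Span x [] x
      _∷_ : ∀ {a ls y} → symAt w x ≡ just a → Span (suc x) ls y → Span x (a ∷ ls) y

    split : ∀ xs {ys x z} → Span x (xs ++ ys) z → ∃ λ y → Span x xs y × Span y ys z
    split []       s       = _ , [] (start s) , s
      where
      start : ∀ {x ls y} → Span x ls y → x ≤ suc (length w)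
      start ([] h)  = h
      start (e ∷ s) = m≤n⇒m≤1+n (symAt-just⇒≤ w e)
    split (a ∷ xs) (e ∷ s) with split xs s
    ... | y , s₁ , s₂ = y , e ∷ s₁ , s₂

    span-length : ∀ {x ls y} → Span x ls y → length ls + x ≡ y
    span-length ([] _)            = refl
    span-length {x} (_∷_ {ls = ls} e s) = trans (sym (+-suc (length ls) x)) (span-length s)

    span-end : ∀ {x ls y} → Span x ls y → y ≤ suc (length w)
    span-end ([] h)  = h
    span-end (e ∷ s) = span-end s

    does-addC : ∀ n {v c d x k m stk} → n + c ≤ suc (length w) →
                addC n ⊨ σ v c d x k m stk ⇓ tt , σ v (n + c) d x k m stk
    does-addC zero    h = pure
    does-addC (suc n) h = does-addC n (<⇒≤ h) ► does-inc rC (≤-pred h)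

    does-digits : ∀ k m {v c d x n l stk y} → length (encBin m) ≤ k → Span (suc d) (encBin m ++ ♯ ∷ []) y →
                  ∃ λ d′ → digits k ⊨ σ v c d x n l stk ⇓ encBin m , σ v c d′ x n l stk
    does-digits zero    Bin.zero h s = _ , pure
    does-digits (suc k) Bin.zero h (e ∷ s) =
      _ , (does-inc rD (<⇒≤ (symAt-just⇒≤ w e)) ► does-readAt (suc (suc zero)) (m≤n⇒m≤1+n (symAt-just⇒≤ w e)) e ► pure)
    does-digits (suc k) 2[1+ m ] (s≤s h) (e ∷ s) with does-digits k m h s
    ... | d′ , D = d′ , (does-inc rD (<⇒≤ (symAt-just⇒≤ w e)) ►
      does-readAt (suc (suc zero)) (m≤n⇒m≤1+n (symAt-just⇒≤ w e)) e ► D ► pure)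
    does-digits (suc k) 1+[2 m ] (s≤s h) (e ∷ s) with does-digits k m h s
    ... | d′ , D = d′ , (does-inc rD (<⇒≤ (symAt-just⇒≤ w e)) ►
      does-readAt (suc (suc zero)) (m≤n⇒m≤1+n (symAt-just⇒≤ w e)) e ► D ► pure)

    does-readX : ∀ {v c d x n m stk a} → symAt w x ≡ just a →
                 readAt rX ⊨ σ v c d x n m stk ⇓ just a , σ v c d x n m stk
    does-readX e = does-readAt (suc (suc (suc zero))) (m≤n⇒m≤1+n (symAt-just⇒≤ w e)) e

    does-incX : ∀ {v c d x n m stk a} → symAt w x ≡ just a →
                inc rX ⊨ σ v c d x n m stk ⇓ tt , σ v c d (suc x) n m stk
    does-incX e = does-inc rX (symAt-just⇒≤ w e)

    does-skipNumeral : ∀ m {v c d x n l stk y} → Span x (encBin m ++ ♯ ∷ []) y →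
      skipNumeral ⊨ σ v c d x n l stk ⇓ tt , σ v c d y n l stk
    does-skipNumeral Bin.zero (e ∷ [] _) = leave (does-readX e ► does-incX e ► pure)
    does-skipNumeral 2[1+ m ] (e ∷ s) = again (does-readX e ► does-incX e ► pure) (does-skipNumeral m s)
    does-skipNumeral 1+[2 m ] (e ∷ s) = again (does-readX e ► does-incX e ► pure) (does-skipNumeral m s)

-- Navigating in a formula

module Trees (B : List BoolFun) where
  open Navigation B public

  data Label : Set where
    var   : ℕ → Label
    since : Label
    fn    : Fin (length B) → Label

  rank : Label → ℕ
  rank (var _) = 0
  rank since   = 2
  rank (fn i)  = arity B i

  -- Formulae with `S` as one more labelled node, so that navigation and evaluation need not treat
  -- it separately.
  data Tree : Set where
    branch : (l : Label) → Vec Tree (rank l) → Tree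

  encLabel : Label → List Sym
  encLabel (var x) = tV ∷ encNat x
  encLabel since   = tS ∷ []
  encLabel (fn i)  = tF ∷ encNat (toℕ i)

  tokenOf : Label → Token
  tokenOf (var _) = leaf
  tokenOf since   = node 2 secondArgument
  tokenOf (fn i)  = node (arity B i) (fun B i)

  mutual
    encTree : Tree → List Sym
    encTree (branch l ts) = encLabel l ++ encTrees ts

    encTrees : ∀ {k} → Vec Tree k → List Sym
    encTrees []       = []
    encTrees (t ∷ ts) = encTree t ++ encTrees ts

  mutual
    tokens : Tree → ℕ
    tokens (branch l ts) = suc (tokensOf ts)

    tokensOf : ∀ {k} → Vec Tree k → ℕ
    tokensOf []       = 0
    -- In this order the token counter in `skip-trees` matches up to associativity.
    tokensOf (t ∷ ts) = tokensOf ts + tokens t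

  encLabel-length : ∀ l → 1 ≤ length (encLabel l)
  encLabel-length (var x) = s≤s z≤n
  encLabel-length since   = s≤s z≤n
  encLabel-length (fn i)  = s≤s z≤n

  encTree-length : ∀ t → 1 ≤ length (encTree t)
  encTree-length (branch l ts) = ≤-trans (encLabel-length l)
    (≤-trans (m≤m+n _ _) (≤-reflexive (sym (length-++ (encLabel l)))))

  count≤encTrees : ∀ {k} (ts : Vec Tree k) → k ≤ length (encTrees ts)
  count≤encTrees []       = z≤n
  count≤encTrees (t ∷ ts) = ≤-trans (+-mono-≤ (encTree-length t) (count≤encTrees ts))
                                    (≤-reflexive (sym (length-++ (encTree t))))

  mutual
    tokens≤encTree : ∀ t → tokens t ≤ length (encTree t)
    tokens≤encTree (branch l ts) = ≤-trans (+-mono-≤ (encLabel-length l) (tokensOf≤encTrees ts))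
                                           (≤-reflexive (sym (length-++ (encLabel l))))

    tokensOf≤encTrees : ∀ {k} (ts : Vec Tree k) → tokensOf ts ≤ length (encTrees ts)
    tokensOf≤encTrees []       = z≤n
    tokensOf≤encTrees (t ∷ ts) = ≤-trans (≤-reflexive (+-comm (tokensOf ts) _))
      (≤-trans (+-mono-≤ (tokens≤encTree t) (tokensOf≤encTrees ts)) (≤-reflexive (sym (length-++ (encTree t)))))

  fromℕ-length : ∀ (i : Fin (length B)) → length (encBin (Bin.fromℕ (toℕ i))) ≤ length B
  fromℕ-length i = ≤-trans (length-encBin (Bin.fromℕ (toℕ i)))
    (≤-trans (≤-reflexive (Bin.toℕ-fromℕ (toℕ i))) (<⇒≤ (toℕ<n i)))

  heaviest : ∀ {k} → ℕ → Vec Tree k → ℕ → ℕ → ℕ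
  heaviest j []       h best = h
  heaviest j (t ∷ ts) h best =
    if best <ᵇ tokens t then heaviest (suc j) ts j (tokens t) else heaviest (suc j) ts h best

  module Scanning (w : List Sym) (width : ℕ) (large : suc (length w) < 2 ^ width) where
    open Positions w width large public

    does-token : ∀ l {x y v c n m stk} → Span x (encLabel l) y →
                 tokenX ⊨ σ v c 0 x n m stk ⇓ tokenOf l , σ v c 0 x n m stk
    does-token (var _) (e ∷ s) = does-readX e ► pure
    does-token since   (e ∷ s) = does-readX e ► pure
    does-token (fn i) {x} {v = v} {c} {n} {m} {stk} (e ∷ s)
      with does-digits (length B) (Bin.fromℕ (toℕ i)) (fromℕ-length i) s
    ... | d′ , D = does-readX e ► does-copy rX rD ► D ► does-copy rZ rD ►
      subst (λ t → ret t ⊨ σ v c 0 x n m stk ⇓ tokenOf (fn i) , σ v c 0 x n m stk)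
            (sym (trans (cong (functionAt B) (trans (decode-encBin (Bin.fromℕ (toℕ i))) (Bin.toℕ-fromℕ (toℕ i))))
                        (functionAt-toℕ B i))) pure

    does-eat : ∀ l {x y v c d n m stk} → Span x (encLabel l) y →
               eatToken ⊨ σ v c d x n m stk ⇓ tt , σ v c d y n m stk
    does-eat (var x) (e ∷ s)    = does-readX e ► does-incX e ► does-skipNumeral (Bin.fromℕ x) s
    does-eat since   (e ∷ [] _) = does-readX e ► does-incX e
    does-eat (fn i)  (e ∷ s)    = does-readX e ► does-incX e ► does-skipNumeral (Bin.fromℕ (toℕ i)) s

    does-expect : ∀ l {v c d x n m stk} → rank l + c ≤ suc (length w) →
                  expect (tokenOf l) ⊨ σ v c d x n m stk ⇓ tt , σ v (rank l + c) d x n m stk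
    does-expect (var _) h = pure
    does-expect since   h = does-addC 2 h
    does-expect (fn i)  h = does-addC (arity B i) h

    open +-*-Solver

    mutual
      -- A run of `skip` that starts behind the tree is extended to one that starts in front of it.
      -- The registers stay in range because each pending subformula and each counted token occupies
      -- at least one input symbol.
      skip-tree : ∀ t {x y v c n m stk σ′} → Span x (encTree t) y →
        c + length (encTree t) ≤ length w → n + length (encTree t) ≤ length w →
        skip ⊨ σ v c 0 y (tokens t + n) m stk ⇓ tt , σ′ →
        skip ⊨ σ v (suc c) 0 x n m stk ⇓ tt , σ′
      skip-tree (branch l ts) {y = y} {v} {c} {n} {m} {stk} {σ′} s hc hn D with split (encLabel l) s
      ... | y₁ , s₁ , s₂ = again
        (does-lt rZ rC ► does-token l s₁ ► does-eat l s₁ ► does-dec rC refl ►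
         does-inc rN (≤-trans (m≤m+n n _) hn) ►
         does-expect l (≤-trans (+-monoˡ-≤ c (count≤encTrees ts))
           (≤-trans (≤-reflexive (+-comm _ c)) (≤-trans (+-monoʳ-≤ c tail≤) (m≤n⇒m≤1+n hc)))) ► pure)
        (skip-trees ts s₂ (≤-trans (+-monoʳ-≤ c tail≤) hc)
          (≤-trans (≤-reflexive (sym (+-suc n _))) (≤-trans (+-monoʳ-≤ n tail<) hn))
          (subst (λ k → skip ⊨ σ v c 0 y k m stk ⇓ tt , σ′) (sym (+-suc (tokensOf ts) n)) D))
        where
        tail< : suc (length (encTrees ts)) ≤ length (encTree (branch l ts))
        tail< = ≤-trans (+-monoˡ-≤ (length (encTrees ts)) (encLabel-length l))
                        (≤-reflexive (sym (length-++ (encLabel l))))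
        tail≤ : length (encTrees ts) ≤ length (encTree (branch l ts))
        tail≤ = <⇒≤ tail<

      skip-trees : ∀ {k} (ts : Vec Tree k) {x y v c n m stk σ′} → Span x (encTrees ts) y →
        c + length (encTrees ts) ≤ length w → n + length (encTrees ts) ≤ length w →
        skip ⊨ σ v c 0 y (tokensOf ts + n) m stk ⇓ tt , σ′ →
        skip ⊨ σ v (k + c) 0 x n m stk ⇓ tt , σ′
      skip-trees []       ([] _) hc hn D = D
      skip-trees {suc k} (t ∷ ts) {y = y} {v} {c} {n} {m} {stk} {σ′} s hc hn D with split (encTree t) s
      ... | y₁ , s₁ , s₂ = skip-tree t s₁ bound-c (≤-trans (+-monoʳ-≤ n head≤) hn)
        (skip-trees ts s₂ (≤-trans (+-monoʳ-≤ c tail≤) hc) bound-n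
          (subst (λ k → skip ⊨ σ v c 0 y k m stk ⇓ tt , σ′) (+-assoc (tokensOf ts) (tokens t) n) D))
        where
        split-length : length (encTrees (t ∷ ts)) ≡ length (encTree t) + length (encTrees ts)
        split-length = length-++ (encTree t)
        head≤ : length (encTree t) ≤ length (encTrees (t ∷ ts))
        head≤ = ≤-trans (m≤m+n _ _) (≤-reflexive (sym split-length))
        tail≤ : length (encTrees ts) ≤ length (encTrees (t ∷ ts))
        tail≤ = ≤-trans (m≤n+m _ (length (encTree t))) (≤-reflexive (sym split-length))
        bound-c : k + c + length (encTree t) ≤ length w
        bound-c = ≤-trans (+-monoˡ-≤ _ (+-monoˡ-≤ c (count≤encTrees ts)))
          (≤-trans (≤-reflexive (solve 3 (λ a c b → a :+ c :+ b := c :+ (b :+ a)) refl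
                      (length (encTrees ts)) c (length (encTree t))))
                   (subst (λ z → c + z ≤ length w) split-length hc))
        bound-n : tokens t + n + length (encTrees ts) ≤ length w
        bound-n = ≤-trans (+-monoˡ-≤ _ (+-monoˡ-≤ n (tokens≤encTree t)))
          (≤-trans (≤-reflexive (solve 3 (λ a n b → a :+ n :+ b := n :+ (a :+ b)) refl
                      (length (encTree t)) n (length (encTrees ts))))
                   (subst (λ z → n + z ≤ length w) split-length hn))

    span≤ : ∀ {x ls y} → Span (suc x) ls y → length ls ≤ length w
    span≤ {x} {ls} s = ≤-pred (≤-trans (s≤s (m≤m+n (length ls) x))
      (≤-trans (≤-reflexive (sym (+-suc (length ls) x))) (≤-trans (≤-reflexive (span-length s)) (span-end s))))

    span-≤ : ∀ {x ls y} → Span x ls y → x ≤ y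
    span-≤ {x} {ls} s = ≤-trans (m≤n+m x (length ls)) (≤-reflexive (span-length s))

    span-< : ∀ {x t y} → Span x (encTree t) y → x < y
    span-< {x} {t} s = ≤-trans (+-monoˡ-≤ x (encTree-length t)) (≤-reflexive (span-length s))

    skip-stop : ∀ {v x n m stk} → skip ⊨ σ v 0 0 x n m stk ⇓ tt , σ v 0 0 x n m stk
    skip-stop = leave (does-lt rZ rC ► pure)

    does-ltMN : ∀ {v c d x n m stk b} → (m <ᵇ n) ≡ b → lt rM rN ⊨ σ v c d x n m stk ⇓ b , σ v c d x n m stk
    does-ltMN refl = does-lt rM rN

    does-heavier : ∀ {k} (ts : Vec Tree k) j h {x y v m stk} → Span (suc x) (encTrees ts) y →
      ∃ λ m′ → heavierFrom j k h ⊨ σ v 0 0 (suc x) 0 m stk ⇓ heaviest j ts h m , σ v 0 0 y 0 m′ stk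
    does-heavier [] j h ([] _) = _ , pure
    does-heavier {suc k} (t ∷ ts) j h {y = y} {v} {m} {stk} s with split (encTree t) s
    ... | zero , s₁ , s₂ = ⊥-elim (n≮0 (span-< {t = t} s₁))
    ... | suc y₁ , s₁ , s₂
      with m <ᵇ tokens t in e
         | does-heavier ts (suc j) j {v = v} {m = tokens t} {stk} s₂
         | does-heavier ts (suc j) h {v = v} {m = m} {stk} s₂
    ... | true | m′ , D | _ = m′ ,
      (does-inc rC z≤n ► skip-tree t s₁ (span≤ s₁) (span≤ s₁) skip-stop ►
       does-ltMN (trans (cong (m <ᵇ_) (+-identityʳ (tokens t))) e) ►
       does-copy rN rM ► does-copy rZ rN ►
       subst (λ z → heavierFrom (suc j) k j ⊨ σ v 0 0 (suc y₁) 0 z stk ⇓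
                    heaviest (suc j) ts j (tokens t) , σ v 0 0 y 0 m′ stk)
             (sym (+-identityʳ (tokens t))) D)
    ... | false | _ | m′ , D = m′ ,
      (does-inc rC z≤n ► skip-tree t s₁ (span≤ s₁) (span≤ s₁) skip-stop ►
       does-ltMN (trans (cong (m <ᵇ_) (+-identityʳ (tokens t))) e) ►
       pure {x = tt} ► does-copy rZ rN ► D)

    does-heavyChild : ∀ l ts {x y v stk} → Span (suc x) (encTree (branch l ts)) y → v ≡ suc x →
      heavyChild (rank l) ⊨ σ v 0 0 0 0 0 stk ⇓ heaviest 0 ts 0 0 , σ v 0 0 0 0 0 stk
    does-heavyChild l ts s refl with split (encLabel l) s
    ... | zero , s₁ , s₂ = ⊥-elim (n≮0 (span-≤ s₁))
    ... | suc y₁ , s₁ , s₂ with does-heavier ts 0 0 {m = 0} s₂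
    ... | m′ , D = does-copy rV rX ► does-eat l s₁ ► D ► does-copy rZ rM ► does-copy rZ rX ► pure

    -- Child i of the sequence starting at x occupies the positions from xᵢ to yᵢ.
    data Located : ∀ {k} → Vec Tree k → Fin k → (x xᵢ yᵢ : ℕ) → Set where
      here  : ∀ {k t} {ts : Vec Tree k} {x y} → Span x (encTree t) y → Located (t ∷ ts) zero x x y
      there : ∀ {k t} {ts : Vec Tree k} {i x y xᵢ yᵢ} → Span x (encTree t) y → Located ts i y xᵢ yᵢ →
              Located (t ∷ ts) (suc i) x xᵢ yᵢ

    locate : ∀ {k} (ts : Vec Tree k) i {x y} → Span x (encTrees ts) y → ∃₂ λ xᵢ yᵢ → Located ts i x xᵢ yᵢ
    locate (t ∷ ts) i s with split (encTree t) s
    locate (t ∷ ts) zero    s | _ , s₁ , s₂ = _ , _ , here s₁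
    locate (t ∷ ts) (suc i) s | _ , s₁ , s₂ with locate ts i s₂
    ... | _ , _ , L = _ , _ , there s₁ L

    located-span : ∀ {k} {ts : Vec Tree k} {i x xᵢ yᵢ} → Located ts i x xᵢ yᵢ → Span xᵢ (encTree (lookup ts i)) yᵢ
    located-span (here s)    = s
    located-span (there s L) = located-span L

    located-≥ : ∀ {k} {ts : Vec Tree k} {i x xᵢ yᵢ} → Located ts i x xᵢ yᵢ → toℕ i + x ≤ xᵢ
    located-≥ (here s) = ≤-refl
    located-≥ {i = suc i} {x = x} (there {t = t} s L) =
      ≤-trans (≤-reflexive (sym (+-suc (toℕ i) x))) (≤-trans (+-monoʳ-≤ (toℕ i) (span-< {t = t} s)) (located-≥ L))

    located-end : ∀ {k} {ts : Vec Tree k} {i x xᵢ yᵢ} → Located ts i x xᵢ yᵢ → xᵢ < yᵢ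
    located-end {ts = ts} {i} L = span-< {t = lookup ts i} (located-span L)

    -- The tokens counted so far lie before position `x`, which bounds `rN`; the siblings still to
    -- be skipped lie before child `i`, which bounds `rC`.
    skip-to : ∀ {k} {ts : Vec Tree k} {i x xᵢ yᵢ n v m stk} → Located ts i x xᵢ yᵢ → n < x →
      ∃ λ n′ → skip ⊨ σ v (toℕ i) 0 x n m stk ⇓ tt , σ v 0 0 xᵢ n′ m stk
    skip-to (here s) h = _ , skip-stop
    skip-to {i = suc i} {x} {xᵢ} {yᵢ} {n} (there {t = t} {y = y} s L) h with skip-to L lower
      where
      lower : tokens t + n < y
      lower = ≤-trans (≤-reflexive (sym (+-suc (tokens t) n)))
        (≤-trans (+-mono-≤ (tokens≤encTree t) h) (≤-reflexive (span-length s)))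
    ... | n′ , D = n′ , skip-tree t s bound-c bound-n D
      where
      ℓ = length (encTree t)
      bound-n : n + ℓ ≤ length w
      bound-n = ≤-pred (≤-trans (+-monoˡ-≤ ℓ h) (≤-trans (≤-reflexive (trans (+-comm x ℓ) (span-length s))) (span-end s)))
      bound-c : toℕ i + ℓ ≤ length w
      bound-c = ≤-pred (begin
        suc (toℕ i + ℓ)       ≡⟨ sym (+-suc (toℕ i) ℓ) ⟩
        toℕ i + suc ℓ         ≤⟨ +-monoʳ-≤ (toℕ i) (+-monoˡ-≤ ℓ (≤-trans (s≤s z≤n) h)) ⟩
        toℕ i + (x + ℓ)       ≡⟨ cong (toℕ i +_) (trans (+-comm x ℓ) (span-length s)) ⟩
        toℕ i + y             ≤⟨ located-≥ L ⟩
        xᵢ                    ≤⟨ <⇒≤ (located-end L) ⟩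
        yᵢ                    ≤⟨ span-end (located-span L) ⟩
        suc (length w)        ∎)
        where open ≤-Reasoning

    located-≤ : ∀ {k} {ts : Vec Tree k} {i x xᵢ yᵢ} → Located ts i x xᵢ yᵢ → x ≤ xᵢ
    located-≤ {i = i} L = ≤-trans (m≤n+m _ (toℕ i)) (located-≥ L)

    does-goChild : ∀ l {ts : Vec Tree (rank l)} i {x y xᵢ yᵢ stk} → Span (suc x) (encLabel l) y → Located ts i y xᵢ yᵢ →
      goChild (toℕ i) ⊨ σ (suc x) 0 0 0 0 0 stk ⇓ tt , σ xᵢ 0 0 0 0 0 stk
    does-goChild l i {x} {y} {stk = stk} s L 
      with skip-to {n = 0} {v = suc x} {m = 0} {stk = stk} L (≤-trans (s≤s z≤n) (span-≤ s))
    ... | n′ , D = does-copy rV rX ► does-eat l s ►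
      subst (λ c → addC (toℕ i) ⊨ σ (suc x) 0 0 y 0 0 stk ⇓ tt , σ (suc x) c 0 y 0 0 stk) (+-identityʳ (toℕ i))
        (does-addC (toℕ i) (≤-trans (≤-reflexive (+-identityʳ _))
          (≤-trans (m≤m+n (toℕ i) _) (≤-trans (located-≥ L) (≤-trans (<⇒≤ (located-end L)) (span-end (located-span L))))))) ►
      D ► does-copy rX rV ► does-copy rZ rX ► does-copy rZ rN

    data NonToken : Sym → Set where
      𝟎 : NonToken 𝟎
      𝟏 : NonToken 𝟏
      ♯ : NonToken ♯

    encBin-nonToken : ∀ m → All NonToken (encBin m ++ ♯ ∷ [])
    encBin-nonToken Bin.zero = ♯ ∷ []
    encBin-nonToken 2[1+ m ] = 𝟎 ∷ encBin-nonToken m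
    encBin-nonToken 1+[2 m ] = 𝟏 ∷ encBin-nonToken m

    does-nonToken : ∀ {a x v c n m stk} → NonToken a → symAt w x ≡ just a →
                    tokenX ⊨ σ v c 0 x n m stk ⇓ other , σ v c 0 x n m stk
    does-nonToken 𝟎 e = does-readX e ► pure
    does-nonToken 𝟏 e = does-readX e ► pure
    does-nonToken ♯ e = does-readX e ► pure

    does-readV : ∀ {v c d x n m stk a} → symAt w v ≡ just a →
                 readAt rV ⊨ σ v c d x n m stk ⇓ just a , σ v c d x n m stk
    does-readV e = does-readAt zero (m≤n⇒m≤1+n (symAt-just⇒≤ w e)) e

    below-yes : ∀ k j {v c d x m stk} → j < k →
                below k ⊨ σ v c d x j m stk ⇓ just j , σ v c d x 0 m stk
    below-yes (suc k) zero    h       = does-lt rZ rN ► pure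
    below-yes (suc k) (suc j) (s≤s h) = does-lt rZ rN ► does-dec rN refl ► below-yes k j h ► pure

    below-no : ∀ k j {v c d x m stk} →
               below k ⊨ σ v c d x (k + j) m stk ⇓ nothing , σ v c d x j m stk
    below-no zero    j = pure
    below-no (suc k) j = does-lt rZ rN ► does-dec rN refl ► below-no k j ► pure

    at-V : ℕ → ℕ → List Frame → State
    at-V v c stk = σ v c 0 0 0 0 stk

    does-tokenV : ∀ l {x y c stk} → Span x (encLabel l) y →
                  tokenV ⊨ at-V x c stk ⇓ tokenOf l , at-V x c stk
    does-tokenV l s = does-copy rV rX ► does-token l s ► does-copy rZ rX ► pure

    climb-past : ∀ l {x c stk} → c ≤ length w →
      climb (tokenOf l) ⊨ at-V x (rank l + c) stk ⇓ inj₁ tt , at-V x (suc c) stk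
    climb-past (var _) h = does-inc rC h ► pure
    climb-past since {c = c} h =
      does-copy rC rN ► below-no 2 c ► does-copy rN rC ► does-copy rZ rN ► does-inc rC h ► pure
    climb-past (fn i) {c = c} h =
      does-copy rC rN ► below-no (arity B i) c ► does-copy rN rC ► does-copy rZ rN ► does-inc rC h ► pure

    climb-found : ∀ l {x c stk} → c < rank l →
      climb (tokenOf l) ⊨ at-V x c stk ⇓ inj₂ true , at-V x c stk
    climb-found since  h = does-copy rC rN ► below-yes 2 _ h ► pure
    climb-found (fn i) h = does-copy rC rN ► below-yes (arity B i) _ h ► pure

    -- Leftwards, a label is entered from the end of its numeral, whose symbols must be passed
    -- without changing the count.
    back-nonTokens : ∀ {x ls y c stk r σ′} → All NonToken ls → Span x ls y → 
      parent ⊨ at-V x c stk ⇓ r , σ′ → parent ⊨ at-V y c stk ⇓ r , σ′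
    back-nonTokens []       ([] _)  D = D
    back-nonTokens (a ∷ as) (e ∷ s) D = back-nonTokens as s (again
      (does-dec rV refl ► does-readV e ►
        (does-copy rV rX ► does-nonToken a e ► does-copy rZ rX ► pure) ► pure) D)

    label-tail : ∀ l {x y} → Span x (encLabel l) y →
      (∃ λ a → symAt w x ≡ just a) × ∃ λ ls → All NonToken ls × Span (suc x) ls y
    label-tail (var x) (e ∷ s) = (_ , e) , _ , encBin-nonToken (Bin.fromℕ x) , s
    label-tail since   (e ∷ s) = (_ , e) , _ , [] , s
    label-tail (fn i)  (e ∷ s) = (_ , e) , _ , encBin-nonToken (Bin.fromℕ (toℕ i)) , s

    back-past : ∀ l {x y c stk r σ′} → Span x (encLabel l) y → c ≤ length w →
      parent ⊨ at-V x (suc c) stk ⇓ r , σ′ → parent ⊨ at-V y (rank l + c) stk ⇓ r , σ′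
    back-past l s h D with label-tail l s
    ... | (_ , e) , _ , nt , s′ = back-nonTokens nt s′
      (again (does-dec rV refl ► does-readV e ► does-tokenV l s ► climb-past l h) D)

    back-found : ∀ l {x y c stk} → Span x (encLabel l) y → c < rank l →
      parent ⊨ at-V y c stk ⇓ true , at-V x c stk
    back-found l s h with label-tail l s
    ... | (_ , e) , _ , nt , s′ = back-nonTokens nt s′
      (leave (does-dec rV refl ► does-readV e ► does-tokenV l s ► climb-found l h))

    mutual
      -- Read from the right, prefix notation is postfix: the children are counted first, and their
      -- label then replaces `rank l` complete subformulae by one.
      back-tree : ∀ t {x y c stk r σ′} → Span x (encTree t) y → c + y ≤ suc (length w) →
        parent ⊨ at-V x (suc c) stk ⇓ r , σ′ → parent ⊨ at-V y c stk ⇓ r , σ′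
      back-tree (branch l ts) {c = c} s h D with split (encLabel l) s
      ... | y₁ , s₁ , s₂ = back-trees ts s₂ h (back-past l s₁
        (≤-pred (≤-trans (≤-reflexive (+-comm 1 c))
          (≤-trans (+-monoʳ-≤ c (≤-trans (s≤s z≤n) (span-< {t = branch l ts} s))) h))) D)

      back-trees : ∀ {k} (ts : Vec Tree k) {x y c stk r σ′} → Span x (encTrees ts) y → c + y ≤ suc (length w) →
        parent ⊨ at-V x (k + c) stk ⇓ r , σ′ → parent ⊨ at-V y c stk ⇓ r , σ′
      back-trees []       ([] _) h D = D
      back-trees {suc k} (t ∷ ts) {y = y} {c} s h D with split (encTree t) s
      ... | y₁ , s₁ , s₂ = back-trees ts s₂ h (back-tree t s₁ bound D)
        where
        bound : k + c + y₁ ≤ suc (length w)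
        bound = begin
          k + c + y₁                       ≡⟨ solve 3 (λ k c y → k :+ c :+ y := c :+ (k :+ y)) refl k c y₁ ⟩
          c + (k + y₁)                     ≤⟨ +-monoʳ-≤ c (+-monoˡ-≤ y₁ (count≤encTrees ts)) ⟩
          c + (length (encTrees ts) + y₁)  ≡⟨ cong (c +_) (span-length s₂) ⟩
          c + y                            ≤⟨ h ⟩
          suc (length w)                   ∎
          where open ≤-Reasoning

    back-located : ∀ {k} {ts : Vec Tree k} {i x xᵢ yᵢ c stk r σ′} → Located ts i x xᵢ yᵢ →
      c + xᵢ ≤ suc (length w) →
      parent ⊨ at-V x (toℕ i + c) stk ⇓ r , σ′ → parent ⊨ at-V xᵢ c stk ⇓ r , σ′
    back-located (here _) h D = D
    back-located {i = suc i} {xᵢ = xᵢ} {c = c} (there {t = t} {y = y} s L) h D =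
      back-located L h (back-tree t s bound D)
      where
      bound : toℕ i + c + y ≤ suc (length w)
      bound = begin
        toℕ i + c + y    ≡⟨ solve 3 (λ k c y → k :+ c :+ y := c :+ (k :+ y)) refl (toℕ i) c y ⟩
        c + (toℕ i + y)  ≤⟨ +-monoʳ-≤ c (located-≥ L) ⟩
        c + xᵢ           ≤⟨ h ⟩
        suc (length w)   ∎
        where open ≤-Reasoning

    does-parent : ∀ l {ts : Vec Tree (rank l)} {i x y xᵢ yᵢ stk} → Span x (encLabel l) y → Located ts i y xᵢ yᵢ →
      parent ⊨ at-V xᵢ 0 stk ⇓ true , at-V x (toℕ i) stk
    does-parent l {i = i} {x} {y} {stk = stk} s L =
      back-located L (≤-trans (<⇒≤ (located-end L)) (span-end (located-span L)))
        (subst (λ c → parent ⊨ at-V y c stk ⇓ true , at-V x (toℕ i) stk) (sym (+-identityʳ (toℕ i)))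
          (back-found l s (toℕ<n i)))

    does-parent-root : ∀ {stk} → parent ⊨ at-V 1 0 stk ⇓ false , at-V 0 0 stk
    does-parent-root = leave (does-dec rV refl ► does-readAt zero z≤n refl ► pure)

-- Looking up a variable

-- Variable indices can be exponential in the input length and so exceed every register. They are
-- compared digit by digit in the input, which is sound because bijective numerals are unique.
sameNumeral : ℕᵇ → ℕᵇ → Bool
sameNumeral Bin.zero Bin.zero = true
sameNumeral 2[1+ m ] 2[1+ n ] = sameNumeral m n
sameNumeral 1+[2 m ] 1+[2 n ] = sameNumeral m n
sameNumeral _        _        = false

labelled : ℕ → List ℕ → Bool
labelled x []       = false
labelled x (y ∷ ys) = if sameNumeral (Bin.fromℕ x) (Bin.fromℕ y) then true else labelled x ys

encLabels : List ℕ → List Sym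
encLabels ys = ⟪ ∷ concat (map encNat ys) ++ ⟫ ∷ []

encStates : ∀ {k} → Vec (List ℕ) k → List Sym
encStates []         = []
encStates (ys ∷ yss) = encLabels ys ++ encStates yss

encNat-≢⟪ : ∀ k → All (_≢ ⟪) (encNat k)
encNat-≢⟪ k = numeral (Bin.fromℕ k)
  where
  numeral : ∀ b → All (_≢ ⟪) (encBin b ++ ♯ ∷ [])
  numeral Bin.zero = (λ ()) ∷ []
  numeral 2[1+ b ] = (λ ()) ∷ numeral b
  numeral 1+[2 b ] = (λ ()) ∷ numeral b

labels-≢⟪ : ∀ ys → All (_≢ ⟪) (concat (map encNat ys) ++ ⟫ ∷ [])
labels-≢⟪ []       = (λ ()) ∷ []
labels-≢⟪ (y ∷ ys) = subst (All (_≢ ⟪)) (sym (++-assoc (encNat y) (concat (map encNat ys)) _))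
                          (All.++⁺ (encNat-≢⟪ y) (labels-≢⟪ ys))

module Lookup (B : List BoolFun) where
  open Trees B public

  findEnd-step : Maybe Sym → Prog (⊤ ⊎ ⊤)
  findEnd-step nothing  = stop tt
  findEnd-step (just _) = inc rX >> continue

  findEnd : Prog ⊤
  findEnd = repeat finite-⊤ (readAt rX >>= findEnd-step)

  double-loop doubleC : Prog ⊤
  double-loop = repeat finite-⊤ (lt rZ rD >>= λ b →
    if b then (dec rD >> inc rC >> continue) else stop tt)
  doubleC = copy rC rD >> double-loop

  decode-step : Maybe Sym → Prog (⊤ ⊎ ⊤)
  decode-step (just 𝟎) = doubleC >> inc rC >> inc rC >> continue
  decode-step (just 𝟏) = doubleC >> inc rC >> continue
  decode-step _        = stop tt

  -- Horner's scheme: read leftwards, a numeral shows its leading digit first.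
  decodeState : Prog ⊤
  decodeState = repeat finite-⊤ (dec rX >> (readAt rX >>= decode-step))

  findBlock-step : Maybe Sym → Prog (⊤ ⊎ ⊤)
  findBlock-step (just ⟪) = lt rZ rC >>= λ b → if b then (dec rC >> continue) else stop tt
  findBlock-step _        = continue

  -- The symbol `⟪` occurs only at the start of a block of labels, so counting its occurrences from
  -- the very beginning of the input finds the block without parsing formula or transition matrix.
  findBlock : Prog ⊤
  findBlock = repeat finite-⊤ (readAt rX >>= λ a → inc rX >> findBlock-step a)

  compareSyms : Maybe Sym → Maybe Sym → Prog (⊤ ⊎ Bool)
  compareSyms (just 𝟎) (just 𝟎) = inc rN >> inc rM >> continue
  compareSyms (just 𝟏) (just 𝟏) = inc rN >> inc rM >> continue
  compareSyms (just ♯) (just ♯) = stop true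
  compareSyms _        _        = stop false

  compareNumerals : Prog Bool
  compareNumerals = repeat finite-Bool (readAt rN >>= λ a → readAt rM >>= λ b → compareSyms a b)

  searchBlock-step : Maybe Sym → Prog (⊤ ⊎ Bool)
  searchBlock-step (just ⟫) = stop false
  searchBlock-step _        =
    copy rV rN >> inc rN >> copy rX rM >> (compareNumerals >>= λ b →
    if b then stop true else (skipNumeral >> continue))

  searchBlock : Prog Bool
  searchBlock = repeat finite-Bool (readAt rX >>= searchBlock-step)

  -- The state number is the last item of the input. After `findEnd`, the `dec rX` moves back to its
  -- closing `♯`; `decodeState` decrements again before it reads, and stops at the `⟫` in front of
  -- the numeral.
  lookupVar : Prog Bool
  lookupVar = copy rV rX >> findEnd >> dec rX >> decodeState >> clear rX >> inc rX >> findBlock >>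
    (searchBlock >>= λ b → clear rX >> clear rN >> clear rM >> ret b)

  module Searching (w : List Sym) (width : ℕ) (large : suc (length w) < 2 ^ width) where
    open Scanning w width large public

    does-findEnd : ∀ k {x v c d n m stk} → k + suc x ≡ suc (length w) →
      findEnd ⊨ σ v c d (suc x) n m stk ⇓ tt , σ v c d (suc (length w)) n m stk
    does-findEnd zero    refl = leave (does-readAt (suc (suc (suc zero))) ≤-refl (symAt-end w) ► pure)
    does-findEnd (suc k) {x} e with symAt-just w (≤-trans (m≤n+m (suc x) k) (≤-reflexive (suc-injective e)))
    ... | _ , e′ = again (does-readX e′ ► does-incX e′ ► pure) (does-findEnd k (trans (+-suc k (suc x)) e))

    does-double-loop : ∀ d {v c x n m stk} → d + c ≤ suc (length w) →
      double-loop ⊨ σ v c d x n m stk ⇓ tt , σ v (d + c) 0 x n m stk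
    does-double-loop zero    h = leave (does-lt rZ rD ► pure)
    does-double-loop (suc d) {v} {c} {x} {n} {m} {stk} h = again
      (does-lt rZ rD ► does-dec rD refl ► does-inc rC (≤-pred (≤-trans (s≤s (m≤n+m c d)) h)) ► pure)
      (subst (λ z → double-loop ⊨ σ v (suc c) d x n m stk ⇓ tt , σ v z 0 x n m stk) (+-suc d c)
        (does-double-loop d (subst (_≤ suc (length w)) (sym (+-suc d c)) h)))

    does-double : ∀ {v c x n m stk} → c + c ≤ suc (length w) →
      doubleC ⊨ σ v c 0 x n m stk ⇓ tt , σ v (c + c) 0 x n m stk
    does-double h = does-copy rC rD ► does-double-loop _ h

    -- Numerals are written least significant digit first, so the leftward scan deals with the inner
    -- numeral `b` before the digit at `x`, and each digit doubles what has been accumulated.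
    does-decode : ∀ b {x y v n m stk r σ′} → Span x (encBin b) y → Bin.toℕ b ≤ length w →
      decodeState ⊨ σ v (Bin.toℕ b) 0 x n m stk ⇓ r , σ′ → decodeState ⊨ σ v 0 0 y n m stk ⇓ r , σ′
    does-decode Bin.zero ([] _) h D = D
    does-decode 2[1+ b ] {x} {v = v} {n} {m} {stk} {r} {σ′} (e ∷ s) h D =
      does-decode b s (<⇒≤ (≤-trans (m≤m+n _ _) h)) (again
        (does-dec rX refl ► does-readX e ► does-double (<⇒≤ (<⇒≤ h′)) ►
         does-inc rC (<⇒≤ (≤-pred h′)) ► does-inc rC (≤-pred h′) ► pure)
        (subst (λ c → decodeState ⊨ σ v c 0 x n m stk ⇓ r , σ′) same D))
      where
      k = Bin.toℕ b
      same : 2 * suc k ≡ suc (suc (k + k))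
      same = cong suc (trans (+-suc k (k + 0)) (cong (λ z → suc (k + z)) (+-identityʳ k)))
      h′ : suc (suc (k + k)) ≤ suc (length w)
      h′ = m≤n⇒m≤1+n (subst (_≤ length w) same h)
    does-decode 1+[2 b ] {x} {v = v} {n} {m} {stk} {r} {σ′} (e ∷ s) h D =
      does-decode b s (≤-trans (m≤m+n _ _) (<⇒≤ h)) (again
        (does-dec rX refl ► does-readX e ► does-double (<⇒≤ (m≤n⇒m≤1+n h′)) ►
         does-inc rC (<⇒≤ h′) ► pure)
        (subst (λ c → decodeState ⊨ σ v c 0 x n m stk ⇓ r , σ′) same D))
      where
      k = Bin.toℕ b
      same : suc (2 * k) ≡ suc (k + k)
      same = cong (λ z → suc (k + z)) (+-identityʳ k)
      h′ : suc (k + k) ≤ length w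
      h′ = subst (_≤ length w) same h

    decode-stop : ∀ {x v c n m stk} → symAt w x ≡ just ⟫ →
      decodeState ⊨ σ v c 0 (suc x) n m stk ⇓ tt , σ v c 0 x n m stk
    decode-stop e = leave (does-dec rX refl ► does-readX e ► pure)

    findBlock-pass : ∀ {ls x y v c n m stk r σ′} → All (_≢ ⟪) ls → Span x ls y →
      findBlock ⊨ σ v c 0 y n m stk ⇓ r , σ′ → findBlock ⊨ σ v c 0 x n m stk ⇓ r , σ′
    findBlock-pass [] ([] _) D = D
    findBlock-pass (_∷_ {a} ne nes) (e ∷ s) D =
      again (does-readX e ► does-incX e ► skips a ne) (findBlock-pass nes s D)
      where
      skips : ∀ a {τ} → a ≢ ⟪ → findBlock-step (just a) ⊨ τ ⇓ inj₁ tt , τ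
      skips 𝟎 ne  = pure
      skips 𝟏 ne  = pure
      skips ♯ ne  = pure
      skips ⟪ ne  = contradiction refl ne
      skips ⟫ ne  = pure
      skips tV ne = pure
      skips tF ne = pure
      skips tS ne = pure

    does-findBlock : ∀ {k} (yss : Vec (List ℕ) k) i {x y v n m stk} → Span x (encStates yss) y →
      ∃₂ λ x′ y′ → Span x′ (concat (map encNat (lookup yss i)) ++ ⟫ ∷ []) y′ ×
        (findBlock ⊨ σ v (toℕ i) 0 x n m stk ⇓ tt , σ v 0 0 x′ n m stk)
    does-findBlock (ys ∷ yss) i s with split (encLabels ys) s
    does-findBlock (ys ∷ yss) zero    s | y₁ , e ∷ s₁ , s₂ =
      _ , _ , s₁ , leave (does-readX e ► does-incX e ► does-lt rZ rC ► pure)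
    does-findBlock (ys ∷ yss) (suc i) s | y₁ , e ∷ s₁ , s₂ with does-findBlock yss i s₂
    ... | x′ , y′ , s′ , D = x′ , y′ , s′ ,
      again (does-readX e ► does-incX e ► does-lt rZ rC ► does-dec rC refl ► pure)
            (findBlock-pass (labels-≢⟪ ys) s₁ D)

    does-compare : ∀ a b {v c d x n m stk y z} →
      Span n (encBin a ++ ♯ ∷ []) y → Span m (encBin b ++ ♯ ∷ []) z →
      ∃₂ λ n′ m′ → compareNumerals ⊨ σ v c d x n m stk ⇓ sameNumeral a b , σ v c d x n′ m′ stk
    does-compare a b s t = cases a b s t
      where
      readN : ∀ {v c d x n m stk a} → symAt w n ≡ just a → readAt rN ⊨ σ v c d x n m stk ⇓ just a , σ v c d x n m stk
      readN e = does-readAt (suc (suc (suc (suc zero)))) (m≤n⇒m≤1+n (symAt-just⇒≤ w e)) e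
      readM : ∀ {v c d x n m stk a} → symAt w m ≡ just a → readAt rM ⊨ σ v c d x n m stk ⇓ just a , σ v c d x n m stk
      readM e = does-readAt (suc (suc (suc (suc (suc zero))))) (m≤n⇒m≤1+n (symAt-just⇒≤ w e)) e
      cases : ∀ a b {v c d x n m stk y z} →
        Span n (encBin a ++ ♯ ∷ []) y → Span m (encBin b ++ ♯ ∷ []) z →
        ∃₂ λ n′ m′ → compareNumerals ⊨ σ v c d x n m stk ⇓ sameNumeral a b , σ v c d x n′ m′ stk
      cases Bin.zero Bin.zero (e ∷ s) (f ∷ t) = _ , _ , leave (readN e ► readM f ► pure)
      cases Bin.zero 2[1+ b ] (e ∷ s) (f ∷ t) = _ , _ , leave (readN e ► readM f ► pure)
      cases Bin.zero 1+[2 b ] (e ∷ s) (f ∷ t) = _ , _ , leave (readN e ► readM f ► pure)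
      cases 2[1+ a ] Bin.zero (e ∷ s) (f ∷ t) = _ , _ , leave (readN e ► readM f ► pure)
      cases 2[1+ a ] 1+[2 b ] (e ∷ s) (f ∷ t) = _ , _ , leave (readN e ► readM f ► pure)
      cases 1+[2 a ] Bin.zero (e ∷ s) (f ∷ t) = _ , _ , leave (readN e ► readM f ► pure)
      cases 1+[2 a ] 2[1+ b ] (e ∷ s) (f ∷ t) = _ , _ , leave (readN e ► readM f ► pure)
      cases 2[1+ a ] 2[1+ b ] (e ∷ s) (f ∷ t) with cases a b s t
      ... | n′ , m′ , D = n′ , m′ , again (readN e ► readM f ►
        does-inc rN (symAt-just⇒≤ w e) ► does-inc rM (symAt-just⇒≤ w f) ► pure) D
      cases 1+[2 a ] 1+[2 b ] (e ∷ s) (f ∷ t) with cases a b s t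
      ... | n′ , m′ , D = n′ , m′ , again (readN e ► readM f ►
        does-inc rN (symAt-just⇒≤ w e) ► does-inc rM (symAt-just⇒≤ w f) ► pure) D

    numeral-first : ∀ b {ls x y} → Span x (encBin b ++ ♯ ∷ ls) y → ∃ λ a → symAt w x ≡ just a × a ≢ ⟫
    numeral-first Bin.zero (e ∷ _) = _ , e , λ ()
    numeral-first 2[1+ b ] (e ∷ _) = _ , e , λ ()
    numeral-first 1+[2 b ] (e ∷ _) = _ , e , λ ()

    -- The catch-all clause of `searchBlock-step` computes only once the symbol is known.
    searchBlock-other : ∀ {a} {τ r τ′} → a ≢ ⟫ →
      (copy rV rN >> inc rN >> copy rX rM >> (compareNumerals >>= λ b →
       if b then stop true else (skipNumeral >> continue))) ⊨ τ ⇓ r , τ′ →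
      searchBlock-step (just a) ⊨ τ ⇓ r , τ′
    searchBlock-other {a = 𝟎}  ne D = D
    searchBlock-other {a = 𝟏}  ne D = D
    searchBlock-other {a = ♯}  ne D = D
    searchBlock-other {a = ⟪}  ne D = D
    searchBlock-other {a = ⟫}  ne D = contradiction refl ne
    searchBlock-other {a = tV} ne D = D
    searchBlock-other {a = tF} ne D = D
    searchBlock-other {a = tS} ne D = D

    does-searchBlock : ∀ u ys {x y z v n m stk} → symAt w v ≡ just tV → Span (suc v) (encNat u) z →
      Span x (concat (map encNat ys) ++ ⟫ ∷ []) y →
      ∃ λ x′ → ∃₂ λ n′ m′ → searchBlock ⊨ σ v 0 0 x n m stk ⇓ labelled u ys , σ v 0 0 x′ n′ m′ stk
    does-searchBlock u [] ev su (e ∷ s) = _ , _ , _ , leave (does-readX e ► pure)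
    does-searchBlock u (y ∷ ys) {x} {v = v} {stk = stk} ev su s
      with split (encNat y) (subst (λ ls → Span x ls _) (++-assoc (encNat y) (concat (map encNat ys)) _) s)
    ... | x₁ , s₁ , s₂ with numeral-first (Bin.fromℕ y) s₁
       | does-compare (Bin.fromℕ u) (Bin.fromℕ y) {v} {0} {0} {x} {stk = stk} su s₁
    ... | a , e , ne | n₁ , m₁ , D with sameNumeral (Bin.fromℕ u) (Bin.fromℕ y)
    ... | true = _ , _ , _ , leave (does-readX e ► searchBlock-other ne
      (does-copy rV rN ► does-inc rN (symAt-just⇒≤ w ev) ► does-copy rX rM ► D ► pure))
    ... | false with does-searchBlock u ys {n = n₁} {m₁} {stk} ev su s₂
    ... | x′ , n′ , m′ , D′ = x′ , n′ , m′ , again (does-readX e ► searchBlock-other ne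
      (does-copy rV rN ► does-inc rN (symAt-just⇒≤ w ev) ► does-copy rX rM ► D ►
       does-skipNumeral (Bin.fromℕ y) s₁ ► pure)) D′

    -- How the Kripke structure, with labelling yss, and the initial state i sit in the input.
    record Encodes {k} (yss : Vec (List ℕ) k) (i : Fin k) : Set where
      field
        {prefix}    : List Sym
        {states-at} : ℕ
        {state-at}  : ℕ
        prefix-≢⟪   : All (_≢ ⟪) prefix
        prefix-span : Span 1 prefix states-at
        states-span : Span states-at (encStates yss) (suc state-at)
        states-last : symAt w state-at ≡ just ⟫
        state-span  : Span (suc state-at) (encNat (toℕ i)) (suc (length w))
        state-small : toℕ i ≤ length w

    open Encodes

    does-lookupVar : ∀ {k} {yss : Vec (List ℕ) k} {i} → Encodes yss i →
      ∀ u {v y stk} → Span (suc v) (encLabel (var u)) y →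
      lookupVar ⊨ at-V (suc v) 0 stk ⇓ labelled u (lookup yss i) , at-V (suc v) 0 stk
    does-lookupVar {yss = yss} {i} E u {v} {stk = stk} (e ∷ s)
      with split (encBin (Bin.fromℕ (toℕ i))) (state-span E) | does-findBlock yss i {v = suc v} {0} {0} {stk} (states-span E)
    ... | .(length w) , s₁ , _ ∷ [] _ | x′ , y′ , s₂ , D with does-searchBlock u (lookup yss i) {n = 0} {0} {stk} e s s₂
    ... | x″ , n″ , m″ , D′ =
      does-copy rV rX ► does-findEnd (length w ∸ v) (trans (+-suc _ v) (cong suc (m∸n+n≡m (<⇒≤ (symAt-just⇒≤ w e))))) ►
      does-dec rX refl ►
      does-decode (Bin.fromℕ (toℕ i)) s₁ (≤-trans (≤-reflexive (Bin.toℕ-fromℕ (toℕ i))) (state-small E))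
        (subst (λ c → decodeState ⊨ σ (suc v) c 0 _ 0 0 stk ⇓ tt , σ (suc v) (toℕ i) 0 _ 0 0 stk)
               (sym (Bin.toℕ-fromℕ (toℕ i))) (decode-stop (states-last E))) ►
      does-copy rZ rX ► does-inc rX z≤n ► findBlock-pass (prefix-≢⟪ E) (prefix-span E) D ►
      D′ ► does-copy rZ rX ► does-copy rZ rN ► does-copy rZ rM ► pure

-- Evaluating a formula

-- Indexed by plain numbers, since a frame has the fixed width `frameWidth B` while its indices
-- belong to nodes of various arities.
getBit : ∀ {k} → Vec Bool k → ℕ → Bool
getBit []       _       = false
getBit (b ∷ bs) zero    = b
getBit (b ∷ bs) (suc i) = getBit bs i

setBit : ∀ {k} → Vec Bool k → ℕ → Bool → Vec Bool k
setBit []       _       c = []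
setBit (b ∷ bs) zero    c = c ∷ bs
setBit (b ∷ bs) (suc i) c = b ∷ setBit bs i c

getBit-setBit : ∀ {k} (bs : Vec Bool k) {i} c → i < k → getBit (setBit bs i c) i ≡ c
getBit-setBit (b ∷ bs) {zero}  c h       = refl
getBit-setBit (b ∷ bs) {suc i} c (s≤s h) = getBit-setBit bs c h

getBit-setBit-other : ∀ {k} (bs : Vec Bool k) {i j} c → j ≢ i → getBit (setBit bs i c) j ≡ getBit bs j
getBit-setBit-other []       c ne = refl
getBit-setBit-other (b ∷ bs) {zero}  {zero}  c ne = contradiction refl ne
getBit-setBit-other (b ∷ bs) {zero}  {suc j} c ne = refl
getBit-setBit-other (b ∷ bs) {suc i} {zero}  c ne = refl
getBit-setBit-other (b ∷ bs) {suc i} {suc j} c ne = getBit-setBit-other bs c (ne ∘ cong suc)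

arguments : ∀ {k} n → Vec Bool k → Vec Bool n
arguments n fr = Vec.tabulate (λ i → getBit fr (toℕ i))

≡ᵇ-true : ∀ m n → (m ≡ᵇ n) ≡ true → m ≡ n
≡ᵇ-true m n e = ≡ᵇ⇒≡ m n (subst T (sym e) tt)

≡ᵇ-false : ∀ m n → (m ≡ᵇ n) ≡ false → m ≢ n
≡ᵇ-false m n e refl = subst T e (≡⇒≡ᵇ m n refl)

<ᵇ-true : ∀ m n → (m <ᵇ n) ≡ true → m < n
<ᵇ-true m n e = <ᵇ⇒< m n (subst T (sym e) tt)

<ᵇ-false : ∀ m n → (m <ᵇ n) ≡ false → n ≤ m
<ᵇ-false m n e = ≮⇒≥ λ h → subst T e (<⇒<ᵇ h)

frameWidth-≥2 : ∀ B → 2 ≤ frameWidth B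
frameWidth-≥2 []       = ≤-refl
frameWidth-≥2 (f ∷ B) = ≤-trans (frameWidth-≥2 B) (m≤n+m _ (proj₁ f))

arity≤frameWidth : ∀ B i → arity B i ≤ frameWidth B
arity≤frameWidth (f ∷ B) zero    = m≤m+n _ _
arity≤frameWidth (f ∷ B) (suc i) = ≤-trans (arity≤frameWidth B i) (m≤n+m _ (proj₁ f))

module Evaluation (B : List BoolFun) where
  open Lookup B public

  finite-Mode : Finite (Maybe Bool)
  finite-Mode = finite-Maybe finite-Bool

  avoiding : ℕ → ℕ → ℕ
  avoiding h i = if i ≡ᵇ h then suc i else i

  resume : (n : ℕ) → (Vec Bool n → Bool) → ℕ → Prog (Maybe Bool ⊎ Bool)
  resume n f i = if i <ᵇ n then (goChild i >> ret (inj₁ nothing))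
                 else (pop >>= λ fr → ret (inj₁ (just (f (arguments n fr)))))

  -- The heavy child returns first, and only then is the frame of its parent created; the other
  -- children update that frame. Which child is heavy is recomputed on each return instead of being
  -- stored.
  record-value : (n : ℕ) → (Vec Bool n → Bool) → Bool → ℕ → ℕ → Prog (Maybe Bool ⊎ Bool)
  record-value n f b j h =
    if j ≡ᵇ h then (push (setBit emptyFrame j b) >> resume n f (avoiding h 0))
    else (pop >>= λ fr → push (setBit fr j b) >> resume n f (avoiding h (suc j)))

  ascendAt : Bool → Token → Prog (Maybe Bool ⊎ Bool)
  ascendAt b (node n f) = copy rC rN >> clear rC >> (below n >>= λ j →
                          -- The default is never reached in a proper run: `parent` leaves the index
                          -- of a child in `rC`, which is less than `n`.
                          heavyChild n >>= record-value n f b (Maybe.fromMaybe 0 j))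
  ascendAt b _          = ret (inj₂ b)

  ascend : Bool → Bool → Prog (Maybe Bool ⊎ Bool)
  ascend b true  = tokenV >>= ascendAt b
  ascend b false = ret (inj₂ b)

  descend : Token → Prog (Maybe Bool ⊎ Bool)
  descend leaf             = lookupVar >>= λ b → ret (inj₁ (just b))
  descend (node zero f)    = ret (inj₁ (just (f [])))
  descend (node (suc n) f) = heavyChild (suc n) >>= λ h → goChild h >> ret (inj₁ nothing)
  descend other            = ret (inj₂ false)

  evaluate-step : Maybe Bool → Prog (Maybe Bool ⊎ Bool)
  evaluate-step nothing  = tokenV >>= descend
  evaluate-step (just b) = parent >>= ascend b

  -- Mode nothing: evaluate the subformula at rV.  Mode just b: it has value b.
  -- The heaviest child is evaluated first, while no frame for its parent is on
  -- the stack; so each frame belongs to a subformula of at least twice the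
  -- size of the one under evaluation, and the stack has logarithmic height.
  evaluate : Maybe Bool → Prog Bool
  evaluate = iterate finite-Mode finite-Bool evaluate-step

  -- The counting phase leaves the input head on the right endmarker, where `rewindHead` would stop
  -- at once; hence the initial move.
  program : Prog Bool
  program = move left (rewindHead >> inc rV >> evaluate nothing)

  module _ (env : ℕ → Bool) where
    apply : (l : Label) → Vec Bool (rank l) → Bool
    apply (var x) _  = env x
    apply since   bs = secondArgument bs
    apply (fn i)  bs = fun B i bs

    mutual
      valueOf : Tree → Bool
      valueOf (branch l ts) = apply l (valuesOf ts)

      valuesOf : ∀ {k} → Vec Tree k → Vec Bool k
      valuesOf []       = []
      valuesOf (t ∷ ts) = valueOf t ∷ valuesOf ts

    lookup-valuesOf : ∀ {k} (ts : Vec Tree k) i → lookup (valuesOf ts) i ≡ valueOf (lookup ts i)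
    lookup-valuesOf (t ∷ ts) zero    = refl
    lookup-valuesOf (t ∷ ts) (suc i) = lookup-valuesOf ts i

  -- (h , best) is the running maximum over the first j trees.
  heaviest-max : ∀ {k} j (ts : Vec Tree k) h best →
    (∃ λ i → heaviest j ts h best ≡ j + toℕ i × best ≤ tokens (lookup ts i) ×
             (∀ i′ → tokens (lookup ts i′) ≤ tokens (lookup ts i))) ⊎
    (heaviest j ts h best ≡ h × (∀ i → tokens (lookup ts i) ≤ best))
  heaviest-max j []       h best = inj₂ (refl , λ ())
  heaviest-max j (t ∷ ts) h best with best <ᵇ tokens t in e
  ... | true with heaviest-max (suc j) ts j (tokens t)
  ...   | inj₁ (i , eq , le , mx) = inj₁ (suc i , trans eq (sym (+-suc j (toℕ i))) ,
            ≤-trans (<⇒≤ (<ᵇ-true best _ e)) le , λ { zero → le ; (suc i′) → mx i′ })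
  ...   | inj₂ (eq , mx) = inj₁ (zero , trans eq (sym (+-identityʳ j)) , <⇒≤ (<ᵇ-true best _ e) ,
            λ { zero → ≤-refl ; (suc i′) → mx i′ })
  heaviest-max j (t ∷ ts) h best | false with heaviest-max (suc j) ts h best
  ...   | inj₁ (i , eq , le , mx) = inj₁ (suc i , trans eq (sym (+-suc j (toℕ i))) , le ,
            λ { zero → ≤-trans (<ᵇ-false best _ e) le ; (suc i′) → mx i′ })
  ...   | inj₂ (eq , mx) = inj₂ (eq , λ { zero → <ᵇ-false best _ e ; (suc i′) → mx i′ })

  tokens-positive : ∀ t → 1 ≤ tokens t
  tokens-positive (branch l ts) = s≤s z≤n

  heaviest-child : ∀ {k} (ts : Vec Tree k) →
    k ≡ 0 ⊎ ∃ λ i → heaviest 0 ts 0 0 ≡ toℕ i × (∀ i′ → tokens (lookup ts i′) ≤ tokens (lookup ts i))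
  heaviest-child []          = inj₁ refl
  heaviest-child ts@(t ∷ _) with heaviest-max 0 ts 0 0
  ... | inj₁ (i , e , _ , mx) = inj₂ (i , e , mx)
  -- The search starts with size 0, and every tree has a token.
  ... | inj₂ (_ , mx)         = ⊥-elim (<⇒≱ (tokens-positive t) (mx zero))

  -- `descend` computes only on a constructor form of the arity, whereas `rank l` may be stuck; this
  -- and `descend-suc` bridge the gap.
  descend-zero : ∀ {n} f (bs : Vec Bool n) → n ≡ 0 → descend (node n f) ≡ ret (inj₁ (just (f bs)))
  descend-zero f [] refl = refl

  descend-suc : ∀ {n} f → Fin n → descend (node n f) ≡ (heavyChild n >>= λ h → goChild h >> ret (inj₁ nothing))
  descend-suc {suc n} f i = refl

  child≤tokensOf : ∀ {k} (ts : Vec Tree k) i → tokens (lookup ts i) ≤ tokensOf ts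
  child≤tokensOf (t ∷ ts) zero    = m≤n+m _ _
  child≤tokensOf (t ∷ ts) (suc i) = ≤-trans (child≤tokensOf ts i) (m≤m+n _ _)

  two-children≤tokensOf : ∀ {k} (ts : Vec Tree k) {i j} → i ≢ j →
    tokens (lookup ts i) + tokens (lookup ts j) ≤ tokensOf ts
  two-children≤tokensOf (t ∷ ts) {zero}  {zero}  ne = contradiction refl ne
  two-children≤tokensOf (t ∷ ts) {zero}  {suc j} ne =
    ≤-trans (≤-reflexive (+-comm (tokens t) _)) (+-monoˡ-≤ (tokens t) (child≤tokensOf ts j))
  two-children≤tokensOf (t ∷ ts) {suc i} {zero}  ne = +-monoˡ-≤ (tokens t) (child≤tokensOf ts i)
  two-children≤tokensOf (t ∷ ts) {suc i} {suc j} ne =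
    ≤-trans (two-children≤tokensOf ts (ne ∘ cong suc)) (m≤m+n _ _)

  rank≤frameWidth : ∀ l → rank l ≤ frameWidth B
  rank≤frameWidth (var _) = z≤n
  rank≤frameWidth since   = frameWidth-≥2 B
  rank≤frameWidth (fn i)  = arity≤frameWidth B i

  module Correctness (w : List Sym) (width : ℕ) (large : suc (length w) < 2 ^ width)
                     {states : ℕ} {yss : Vec (List ℕ) states} {start : Fin states} where
    open Searching w width large public

    module _ (E : Encodes yss start) where

      env : ℕ → Bool
      env u = labelled u (lookup yss start)

      val : Tree → Bool
      val = valueOf env

      -- `d` is a budget of further frames. A heavy child inherits budget and stack; a light child
      -- has less than half of `2 ^ d` tokens, so one unit of the budget can pay for the frame of
      -- its parent.
      Fits : Tree → List Frame → Set
      Fits t stk = ∃ λ d → tokens t < 2 ^ d × length stk + d ≤ width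

      fits-heavy : ∀ l ts stk i → Fits (branch l ts) stk → Fits (lookup ts i) stk
      fits-heavy l ts stk i (d , h , g) = d , ≤-trans (s≤s (m≤n⇒m≤1+n (child≤tokensOf ts i))) h , g

      -- Twice a light child is at most the light plus the heavy child, and two distinct children
      -- together have fewer tokens than the node.
      fits-light : ∀ l ts stk {h i} fr → i ≢ h → tokens (lookup ts i) ≤ tokens (lookup ts h) →
                   Fits (branch l ts) stk → Fits (lookup ts i) (fr ∷ stk)
      fits-light l ts stk fr ne le (zero , s≤s () , g)
      fits-light l ts stk {h} {i} fr ne le (suc d , lt , g) = d , half , subst (_≤ width) (+-suc (length stk) d) g
        where
        a = tokens (lookup ts i)
        half : a < 2 ^ d
        half = *-cancelˡ-< 2 a (2 ^ d) (≤-trans (s≤s (≤-trans (≤-reflexive (cong (a +_) (+-identityʳ a)))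
                 (≤-trans (+-monoʳ-≤ a le) (≤-trans (two-children≤tokensOf ts ne) (n≤1+n _))))) lt)

      -- A tree has at least one token, so its budget cannot be 0.
      fits-push : ∀ t stk → Fits t stk → suc (length stk) ≤ width
      fits-push t stk (zero , h , g) = ⊥-elim (<⇒≱ h (tokens-positive t))
      fits-push t stk (suc d , lt , g) = ≤-trans (s≤s (m≤m+n _ d)) (≤-trans (≤-reflexive (sym (+-suc (length stk) d))) g)

      Continues : Prog (Maybe Bool ⊎ Bool) → State → Bool → State → Set₁
      Continues p σ₀ r σ′ = ∃₂ λ mode σ₁ → (p ⊨ σ₀ ⇓ inj₁ mode , σ₁) × (evaluate mode ⊨ σ₁ ⇓ r , σ′)

      -- If the run that has found the value of t succeeds, so does the one that has yet to evaluate t.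
      Evaluates : Tree → Set₁
      Evaluates t = ∀ {x y stk r σ′} → Span (suc x) (encTree t) y → Fits t stk →
        evaluate (just (val t)) ⊨ at-V (suc x) 0 stk ⇓ r , σ′ →
        evaluate nothing ⊨ at-V (suc x) 0 stk ⇓ r , σ′

      -- Fixes an inner node together with the run `done` that follows its evaluation. The visits to
      -- its children are put in front of that run, the last one first.
      module Children (l : Label) (ts : Vec Tree (rank l)) (IH : ∀ i → Evaluates (lookup ts i))
                      {x y₀ z : ℕ} {stk : List Frame} {r : Bool} {σ′ : State}
                      (f : Vec Bool (rank l) → Bool) (token : tokenOf l ≡ node (rank l) f)
                      (label-span : Span (suc x) (encLabel l) y₀) (kids-span : Span y₀ (encTrees ts) z)
                      (whole-span : Span (suc x) (encTree (branch l ts)) z)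
                      (fits : Fits (branch l ts) stk)
                      (heavy : Fin (rank l)) (is-heavy : heaviest 0 ts 0 0 ≡ toℕ heavy)
                      (heavy-max : ∀ i → tokens (lookup ts i) ≤ tokens (lookup ts heavy))
                      (done : evaluate (just (f (valuesOf env ts))) ⊨ at-V (suc x) 0 stk ⇓ r , σ′)
                      where

        -- The heavy child is recorded first and the others in increasing order, hence the two
        -- alternatives.
        Filled : Frame → ℕ → Set
        Filled fr from = ∀ i → toℕ i < from ⊎ i ≡ heavy → getBit fr (toℕ i) ≡ val (lookup ts i)

        child-<width : ∀ (i : Fin (rank l)) → toℕ i < frameWidth B
        child-<width i = ≤-trans (toℕ<n i) (rank≤frameWidth l)

        filled-heavy : Filled (setBit emptyFrame (toℕ heavy) (val (lookup ts heavy))) 0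
        filled-heavy i (inj₂ refl) = getBit-setBit emptyFrame _ (child-<width i)

        filled-suc : ∀ fr i → Filled fr (toℕ i) → Filled (setBit fr (toℕ i) (val (lookup ts i))) (suc (toℕ i))
        filled-suc fr i F i′ c with toℕ i′ ≟ toℕ i
        ... | yes e with toℕ-injective e
        ...   | refl = getBit-setBit fr _ (child-<width i)
        filled-suc fr i F i′ c | no ne = trans (getBit-setBit-other fr _ ne) (F i′ (weaken c))
          where
          weaken : toℕ i′ < suc (toℕ i) ⊎ i′ ≡ heavy → toℕ i′ < toℕ i ⊎ i′ ≡ heavy
          weaken (inj₁ h) = inj₁ (≤∧≢⇒< (≤-pred h) ne)
          weaken (inj₂ e) = inj₂ e

        all-filled : ∀ fr from → rank l ≤ from → Filled fr from → arguments (rank l) fr ≡ valuesOf env ts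
        all-filled fr from h F = trans
          (tabulate-cong λ i → trans (F i (inj₁ (≤-trans (toℕ<n i) h))) (sym (lookup-valuesOf env ts i)))
          (tabulate∘lookup (valuesOf env ts))

        -- One run of the loop body, from a child whose value b has just been found to record-value.
        return-from : ∀ {b i xᵢ yᵢ stk′} → Located ts i y₀ xᵢ yᵢ →
          Continues (record-value (rank l) f b (toℕ i) (toℕ heavy)) (at-V (suc x) 0 stk′) r σ′ →
          evaluate (just b) ⊨ at-V xᵢ 0 stk′ ⇓ r , σ′
        return-from {b} {i} {stk′ = stk′} L (mode , σ₁ , D , D′) = again
          (does-parent l label-span L ► does-tokenV l label-span ►
           subst (λ t → ascendAt b t ⊨ at-V (suc x) (toℕ i) stk′ ⇓ inj₁ mode , σ₁) (sym token)
             (does-copy rC rN ► does-copy rZ rC ► below-yes (rank l) (toℕ i) (toℕ<n i) ►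
              does-heavyChild l ts whole-span refl ►
              subst (λ h → record-value (rank l) f b (toℕ i) h ⊨ at-V (suc x) 0 stk′ ⇓ inj₁ mode , σ₁)
                    (sym is-heavy) D))
          D′

        finish : ∀ fr from → rank l ≤ from → Filled fr from →
          Continues (pop >>= λ fr → ret (inj₁ (just (f (arguments (rank l) fr))))) (at-V (suc x) 0 (fr ∷ stk)) r σ′
        finish fr from h F = _ , _ , (does-pop ► pure) ,
          subst (λ bs → evaluate (just (f bs)) ⊨ at-V (suc x) 0 stk ⇓ r , σ′) (sym (all-filled fr from h F)) done

        Resumes : ℕ → Set₁
        Resumes from = ∀ fr → Filled fr from →
          Continues (resume (rank l) f (avoiding (toℕ heavy) from)) (at-V (suc x) 0 (fr ∷ stk)) r σ′

        visit : ∀ fr i → i ≢ heavy → Filled fr (toℕ i) → Resumes (suc (toℕ i)) →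
          Continues (goChild (toℕ i) >> ret (inj₁ nothing)) (at-V (suc x) 0 (fr ∷ stk)) r σ′
        visit fr i ne F next with locate ts i kids-span
        ... | zero , _ , L = ⊥-elim (n≮0 (≤-trans (span-≤ label-span) (located-≤ L)))
        ... | suc xᵢ , yᵢ , L with next (setBit fr (toℕ i) (val (lookup ts i))) (filled-suc fr i F)
        ... | mode , σ₁ , D , D′ = _ , _ , (does-goChild l i label-span L ► pure) ,
          IH i (located-span L) (fits-light l ts stk fr ne (heavy-max i) fits)
            (return-from L (mode , σ₁ , recorded , D′))
          where
          recorded : record-value (rank l) f (val (lookup ts i)) (toℕ i) (toℕ heavy)
                     ⊨ at-V (suc x) 0 (fr ∷ stk) ⇓ inj₁ mode , σ₁
          recorded with toℕ i ≡ᵇ toℕ heavy in e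
          ... | true  = contradiction (toℕ-injective (≡ᵇ-true (toℕ i) (toℕ heavy) e)) ne
          ... | false = does-pop ► does-push _ (fits-push (branch l ts) stk fits) ► D

        dispatch : ∀ fr i → i ≢ toℕ heavy → Filled fr i → (i < rank l → Resumes (suc i)) →
          Continues (resume (rank l) f i) (at-V (suc x) 0 (fr ∷ stk)) r σ′
        dispatch fr i ne F next with i <ᵇ rank l in e
        ... | false = finish fr i (<ᵇ-false i (rank l) e) F
        ... | true with find (<ᵇ-true i (rank l) e)
          where
          find : i < rank l → ∃ λ j → toℕ j ≡ i
          find h = fromℕ< h , toℕ-fromℕ< h
        ...   | j , refl = visit fr j (λ { refl → ne refl }) F (next (<ᵇ-true i (rank l) e))

        -- Induction on `k`, a bound on the number of children from index `from` on, since `from`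
        -- itself increases.
        resumes : ∀ k from → rank l ≤ k + from → Resumes from
        resumes k from h fr F with from ≡ᵇ toℕ heavy in e
        resumes zero from h fr F | false =
          dispatch fr from (≡ᵇ-false from _ e) F (λ lt → ⊥-elim (<⇒≱ lt h))
        resumes (suc k) from h fr F | false =
          dispatch fr from (≡ᵇ-false from _ e) F
            (λ _ → resumes k (suc from) (subst (rank l ≤_) (sym (+-suc k from)) h))
        resumes zero from h fr F | true =
          ⊥-elim (<⇒≱ (toℕ<n heavy) (subst (rank l ≤_) (≡ᵇ-true from _ e) h))
        resumes (suc k) from h fr F | true =
          -- Index `from` is the heavy child, recorded before all others, so the frame is already
          -- correct up to `suc from`.
          dispatch fr (suc from) (λ e′ → 1+n≢n (trans e′ (sym (≡ᵇ-true from _ e)))) filled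
            (λ _ → resumes k (suc (suc from))
               (≤-trans h (≤-trans (≤-reflexive (sym (+-suc k from))) (+-monoʳ-≤ k (n≤1+n _)))))
          where
          filled : Filled fr (suc from)
          filled i (inj₂ c) = F i (inj₂ c)
          filled i (inj₁ c) with toℕ i ≟ from
          ... | yes e′ = F i (inj₂ (toℕ-injective (trans e′ (≡ᵇ-true from _ e))))
          ... | no ne  = F i (inj₁ (≤∧≢⇒< (≤-pred c) ne))

        evaluates-children : evaluate nothing ⊨ at-V (suc x) 0 stk ⇓ r , σ′
        evaluates-children with locate ts heavy kids-span
        ... | zero , _ , L = ⊥-elim (n≮0 (≤-trans (span-≤ label-span) (located-≤ L)))
        ... | suc xₕ , yₕ , L with resumes (rank l) 0 (m≤m+n (rank l) 0) _ filled-heavy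
        ... | mode , σ₁ , D , D′ = again
          (does-tokenV l label-span ►
           subst (λ q → q ⊨ at-V (suc x) 0 stk ⇓ inj₁ nothing , at-V (suc xₕ) 0 stk)
             (sym (trans (cong descend token) (descend-suc f heavy)))
             (subst (λ h → heavyChild (rank l) ⊨ at-V (suc x) 0 stk ⇓ h , at-V (suc x) 0 stk) is-heavy
                (does-heavyChild l ts whole-span refl) ►
              does-goChild l heavy label-span L ► pure))
          (IH heavy (located-span L) (fits-heavy l ts stk heavy fits) (return-from L (mode , σ₁ , recorded , D′)))
          where
          recorded : record-value (rank l) f (val (lookup ts heavy)) (toℕ heavy) (toℕ heavy)
                     ⊨ at-V (suc x) 0 stk ⇓ inj₁ mode , σ₁
          recorded with toℕ heavy ≡ᵇ toℕ heavy in e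
          ... | true  = does-push _ (fits-push (branch l ts) stk fits) ► D
          ... | false = contradiction refl (≡ᵇ-false (toℕ heavy) (toℕ heavy) e)

      evaluates-node : ∀ l ts f → tokenOf l ≡ node (rank l) f → (∀ bs → apply env l bs ≡ f bs) →
                       (∀ i → Evaluates (lookup ts i)) → Evaluates (branch l ts)
      evaluates-node l ts f token same IH {x} {stk = stk} {r} {σ′} s fits D
        with split (encLabel l) s | heaviest-child ts
      ... | y , s₁ , s₂ | inj₁ none = again
        (does-tokenV l s₁ ► subst (λ q → q ⊨ at-V (suc x) 0 stk ⇓ inj₁ (just (f (valuesOf env ts))) , at-V (suc x) 0 stk)
          (sym (trans (cong descend token) (descend-zero f (valuesOf env ts) none))) pure)
        (subst (λ b → evaluate (just b) ⊨ at-V (suc x) 0 stk ⇓ r , σ′) (same (valuesOf env ts)) D)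
      ... | y , s₁ , s₂ | inj₂ (h , is-heavy , mx) =
        Children.evaluates-children l ts IH f token s₁ s₂ s fits h is-heavy mx
          (subst (λ b → evaluate (just b) ⊨ at-V (suc x) 0 stk ⇓ r , σ′) (same (valuesOf env ts)) D)

      mutual
        evaluates : ∀ t → Evaluates t
        evaluates (branch (var u) []) s fits D with split (encLabel (var u)) s
        ... | y , s₁ , _ = again (does-tokenV (var u) s₁ ► does-lookupVar E u s₁ ► pure) D
        evaluates (branch since ts)  = evaluates-node since ts secondArgument refl (λ _ → refl) (evaluates-all ts)
        evaluates (branch (fn i) ts) = evaluates-node (fn i) ts (fun B i) refl (λ _ → refl) (evaluates-all ts)

        evaluates-all : ∀ {k} (ts : Vec Tree k) i → Evaluates (lookup ts i)
        evaluates-all (t ∷ ts) zero    = evaluates t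
        evaluates-all (t ∷ ts) (suc i) = evaluates-all ts i

      program-correct : ∀ t {y} → Span 1 (encTree t) y →
        program ⊨ ⟨ Vec.replicate 8 0 , [] , suc (length w) ⟩ ⇓ val t , at-V 0 0 []
      program-correct t s = does-move left (does-rewind (length w) ≤-refl ► does-inc rV z≤n ►
        -- The stack is empty at first, so the whole `width` is available as budget.
        evaluates t s (width , ≤-trans (s≤s (≤-trans (tokens≤encTree t) (span≤ s))) (<⇒≤ large) , ≤-refl)
          (leave (does-parent-root ► pure)))

-- Correctness of the encoding and the semantics

open Equivalence using (to; from)

sameNumeral-refl : ∀ m → sameNumeral m m ≡ true
sameNumeral-refl Bin.zero = refl
sameNumeral-refl 2[1+ m ] = sameNumeral-refl m
sameNumeral-refl 1+[2 m ] = sameNumeral-refl m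

sameNumeral⇒≡ : ∀ m n → sameNumeral m n ≡ true → m ≡ n
sameNumeral⇒≡ Bin.zero Bin.zero e = refl
sameNumeral⇒≡ 2[1+ m ] 2[1+ n ] e = cong 2[1+_] (sameNumeral⇒≡ m n e)
sameNumeral⇒≡ 1+[2 m ] 1+[2 n ] e = cong 1+[2_] (sameNumeral⇒≡ m n e)

labelled⇔∈ : ∀ x ys → (labelled x ys ≡ true) ⇔ (x ∈ ys)
labelled⇔∈ x ys = mk⇔ (sound ys) (complete ys)
  where
  sound : ∀ ys → labelled x ys ≡ true → x ∈ ys
  sound (y ∷ ys) e with sameNumeral (Bin.fromℕ x) (Bin.fromℕ y) in same
  ... | false = there (sound ys e)
  ... | true  = here (trans (sym (Bin.toℕ-fromℕ x))
                  (trans (cong Bin.toℕ (sameNumeral⇒≡ (Bin.fromℕ x) (Bin.fromℕ y) same)) (Bin.toℕ-fromℕ y)))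
  complete : ∀ ys → x ∈ ys → labelled x ys ≡ true
  complete (y ∷ ys) (here refl) rewrite sameNumeral-refl (Bin.fromℕ x) = refl
  complete (y ∷ ys) (there x∈)  with sameNumeral (Bin.fromℕ x) (Bin.fromℕ y)
  ... | true  = refl
  ... | false = complete ys x∈

module ModelChecking (B : List BoolFun) where
  open Evaluation B public

  mutual
    toTree : Form B → Tree
    toTree (var x)    = branch (var x) []
    toTree (app i φs) = branch (fn i) (toTrees φs)
    toTree (φ S ψ)    = branch since (toTree φ ∷ toTree ψ ∷ [])

    toTrees : ∀ {k} → Vec (Form B) k → Vec Tree k
    toTrees []       = []
    toTrees (φ ∷ φs) = toTree φ ∷ toTrees φs

  mutual
    encTree-toTree : ∀ φ → encTree (toTree φ) ≡ encForm φ
    encTree-toTree (var x)    = ++-identityʳ _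
    encTree-toTree (app i φs) = cong (λ z → tF ∷ encNat (toℕ i) ++ z) (encTrees-toTrees φs)
    encTree-toTree (φ S ψ)    = cong (tS ∷_) (cong₂ _++_ (encTree-toTree φ)
                                  (trans (++-identityʳ _) (encTree-toTree ψ)))

    encTrees-toTrees : ∀ {k} (φs : Vec (Form B) k) → encTrees (toTrees φs) ≡ encForms φs
    encTrees-toTrees []       = refl
    encTrees-toTrees (φ ∷ φs) = cong₂ _++_ (encTree-toTree φ) (encTrees-toTrees φs)

  encLabel-≢⟪ : ∀ l → All (_≢ ⟪) (encLabel l)
  encLabel-≢⟪ (var x) = (λ ()) ∷ encNat-≢⟪ x
  encLabel-≢⟪ since   = (λ ()) ∷ []
  encLabel-≢⟪ (fn i)  = (λ ()) ∷ encNat-≢⟪ (toℕ i)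

  mutual
    encTree-≢⟪ : ∀ t → All (_≢ ⟪) (encTree t)
    encTree-≢⟪ (branch l ts) = All.++⁺ (encLabel-≢⟪ l) (encTrees-≢⟪ ts)

    encTrees-≢⟪ : ∀ {k} (ts : Vec Tree k) → All (_≢ ⟪) (encTrees ts)
    encTrees-≢⟪ []       = []
    encTrees-≢⟪ (t ∷ ts) = All.++⁺ (encTree-≢⟪ t) (encTrees-≢⟪ ts)

  all-map : ∀ {A C : Set} {Q : C → Set} {k} (g : A → C) (xs : Vec A k) → (∀ x → Q (g x)) →
            All Q (Vec.toList (Vec.map g xs))
  all-map g []       h = []
  all-map g (x ∷ xs) h = h x ∷ all-map g xs h

  module Semantic (K : Kripke) (a : Fin (size K)) (env : ℕ → Bool)
                  (env-correct : ∀ u → (env u ≡ true) ⇔ (u ∈ η K a)) where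

    true-≡ : ∀ {b c} → (b ≡ true → c ≡ true) → (c ≡ true → b ≡ true) → b ≡ c
    true-≡ {false} {false} f g = refl
    true-≡ {false} {true}  f g = g refl
    true-≡ {true}  {c}     f g = sym (f refl)

    module _ (π : Path K) (starts : p π 0 ≡ a) where

      mutual
        -- At time 0 the only possible witness for φ S ψ is time 0 itself.
        sat⇒value : ∀ φ → Sat π 0 φ → valueOf env (toTree φ) ≡ true
        sat⇒value (var x)    s            = from (env-correct x) (subst (λ v → x ∈ η K v) starts s)
        sat⇒value (app i φs) (bs , e , s) = trans (cong (fun B i) (sym (satVec-unique φs bs s))) e
        sat⇒value (φ S ψ) (zero , _ , s , _) = sat⇒value ψ s

        value⇒sat : ∀ φ → valueOf env (toTree φ) ≡ true → Sat π 0 φ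
        value⇒sat (var x)    e = subst (λ v → x ∈ η K v) (sym starts) (to (env-correct x) e)
        value⇒sat (app i φs) e = valuesOf env (toTrees φs) , e , satVec-values φs
        value⇒sat (φ S ψ)    e = zero , z≤n , value⇒sat ψ e , λ { zero () _ ; (suc _) _ () }

        -- The vector in `Sat` for `app` is existential, but the equivalences in `SatVec` determine
        -- each entry. Functions in `B` may fail to be monotone, so both directions are used, which
        -- is why the four proofs are mutual.
        satVec-unique : ∀ {k} (φs : Vec (Form B) k) bs → SatVec π 0 φs bs → bs ≡ valuesOf env (toTrees φs)
        satVec-unique []       []       _        = refl
        satVec-unique (φ ∷ φs) (b ∷ bs) (s , ss) = cong₂ _∷_
          (true-≡ (λ e → sat⇒value φ (to s e)) (λ e → from s (value⇒sat φ e)))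
          (satVec-unique φs bs ss)

        satVec-values : ∀ {k} (φs : Vec (Form B) k) → SatVec π 0 φs (valuesOf env (toTrees φs))
        satVec-values []       = tt
        satVec-values (φ ∷ φs) = mk⇔ (value⇒sat φ) (sat⇒value φ) , satVec-values φs

    somePath : Path K
    somePath = record { p = walk ; step = λ i → proj₂ (total K (walk i)) }
      where
      walk : ℕ → Fin (size K)
      walk zero    = a
      walk (suc i) = proj₁ (total K (walk i))

    value⇔MCYes : ∀ φ → (valueOf env (toTree φ) ≡ true) ⇔
                  MCYes B (record { formula = φ ; structure = K ; state = a })
    value⇔MCYes φ = mk⇔ (λ e → somePath , refl , value⇒sat somePath refl φ e)
                        (λ (π , starts , s) → sat⇒value π starts φ s)

  module Deciding (I : Instance B) (width : ℕ) (large : suc (length (encInstance I)) < 2 ^ width) where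
    K = structure I
    a = state I
    w = encInstance I

    labels : Vec (List ℕ) (size K)
    labels = Vec.map (η K) (allFin (size K))

    open Correctness w width large {size K} {labels} {a}

    row : Fin (size K) → List Sym
    row u = Vec.toList (Vec.map (λ v → encBool (R K u v)) (allFin (size K)))

    beforeStates : List Sym
    beforeStates = encForm (formula I) ++ encNat (size K) ++
                   concat (Vec.toList (Vec.map row (allFin (size K))))

    encStates-map : ∀ {A : Set} {k} (g : A → List ℕ) (xs : Vec A k) →
      concat (Vec.toList (Vec.map (λ u → ⟪ ∷ concat (map encNat (g u)) ++ (⟫ ∷ [])) xs)) ≡ encStates (Vec.map g xs)
    encStates-map g []       = refl
    encStates-map g (x ∷ xs) = cong (encLabels (g x) ++_) (encStates-map g xs)

    decomposed : w ≡ beforeStates ++ encStates labels ++ encNat (toℕ a)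
    decomposed = begin
      F ++ (N ++ Rs ++ Ls) ++ A                 ≡⟨ cong (λ z → F ++ (N ++ Rs ++ z) ++ A) (encStates-map (η K) (allFin (size K))) ⟩
      F ++ (N ++ Rs ++ L) ++ A                  ≡⟨ cong (λ z → F ++ z ++ A) (sym (++-assoc N Rs L)) ⟩
      F ++ ((N ++ Rs) ++ L) ++ A                ≡⟨ cong (F ++_) (++-assoc (N ++ Rs) L A) ⟩
      F ++ (N ++ Rs) ++ L ++ A                  ≡⟨ sym (++-assoc F (N ++ Rs) (L ++ A)) ⟩
      (F ++ N ++ Rs) ++ L ++ A                  ∎
      where
      open ≡-Reasoning
      F = encForm (formula I)
      N = encNat (size K)
      Rs = concat (Vec.toList (Vec.map row (allFin (size K))))
      Ls = concat (Vec.toList (Vec.map (λ u → ⟪ ∷ concat (map encNat (η K u)) ++ (⟫ ∷ [])) (allFin (size K))))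
      L = encStates labels
      A = encNat (toℕ a)

    symAt-++ : ∀ pre {b ls} → symAt (pre ++ b ∷ ls) (suc (length pre)) ≡ just b
    symAt-++ []        = refl
    symAt-++ (_ ∷ pre) = symAt-++ pre

    span-suffix : ∀ pre ls → w ≡ pre ++ ls → Span (suc (length pre)) ls (suc (length w))
    span-suffix pre [] e = subst (λ n → Span n [] (suc (length w)))
      (cong (suc ∘ length) (trans e (++-identityʳ pre))) ([] ≤-refl)
    span-suffix pre (b ∷ ls) e =
      trans (cong (λ v → symAt v (suc (length pre))) e) (symAt-++ pre) ∷
      subst (λ n → Span n ls (suc (length w)))
        (cong suc (trans (length-++ pre) (+-comm (length pre) 1)))
        (span-suffix (pre ++ b ∷ []) ls (trans e (sym (++-assoc pre (b ∷ []) ls))))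

    input-span : Span 1 (beforeStates ++ encStates labels ++ encNat (toℕ a)) (suc (length w))
    input-span = span-suffix [] _ decomposed

    beforeStates-≢⟪ : All (_≢ ⟪) beforeStates
    beforeStates-≢⟪ = All.++⁺ (subst (All (_≢ ⟪)) (encTree-toTree (formula I)) (encTree-≢⟪ (toTree (formula I))))
      (All.++⁺ (encNat-≢⟪ (size K)) (All.concat⁺ (all-map row (allFin (size K)) λ u →
        all-map (λ v → encBool (R K u v)) (allFin (size K)) λ v → bool (R K u v))))
      where
      bool : ∀ b → encBool b ≢ ⟪
      bool true  ()
      bool false ()

    ends-⟫ : ∀ ls {x y} → Span x (ls ++ ⟫ ∷ []) y → ∃ λ q → y ≡ suc q × symAt w q ≡ just ⟫
    ends-⟫ []       (e ∷ [] _) = _ , refl , e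
    ends-⟫ (_ ∷ ls) (e ∷ s)    = ends-⟫ ls s

    -- Some state, such as the initial one, guarantees that there is a last block, whose `⟫` stops
    -- `decodeState`.
    states-end : ∀ {k} (yss : Vec (List ℕ) k) → Fin k → ∀ {x y} → Span x (encStates yss) y →
                 ∃ λ q → y ≡ suc q × symAt w q ≡ just ⟫
    states-end (ys ∷ []) i s with split (encLabels ys) s
    ... | _ , s₁ , [] _ = ends-⟫ (⟪ ∷ concat (map encNat ys)) s₁
    states-end (ys ∷ ys′ ∷ yss) i s =
      states-end (ys′ ∷ yss) zero (proj₂ (proj₂ (split (encLabels ys) s)))

    -- Each state has a block of its own in the input, so the number of the initial state, unlike
    -- that of a variable, fits into a register.
    states-length : ∀ {k} (yss : Vec (List ℕ) k) → k ≤ length (encStates yss)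
    states-length []         = z≤n
    states-length (ys ∷ yss) = s≤s (≤-trans (states-length yss)
      (≤-trans (m≤n+m _ _) (≤-reflexive (sym (length-++ (concat (map encNat ys) ++ ⟫ ∷ []))))))

    encodes : Encodes labels a
    encodes with split beforeStates input-span
    ... | y , s₁ , s₂ with split (encStates labels) s₂
    ... | z , s₃ , s₄ with states-end labels a s₃
    ... | q , refl , e = record
      { prefix-≢⟪ = beforeStates-≢⟪
      ; prefix-span = s₁ ; states-span = s₃ ; states-last = e ; state-span = s₄
      ; state-small = <⇒≤ (≤-trans (toℕ<n a) (≤-trans (states-length labels)
          (≤-trans (m≤m+n _ _) (≤-trans (≤-reflexive (sym (length-++ (encStates labels))))
          (≤-trans (m≤n+m _ (length beforeStates)) (≤-reflexive
            (trans (sym (length-++ beforeStates)) (cong length (sym decomposed)))))))))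
      }

    formula-span : ∃ λ y → Span 1 (encTree (toTree (formula I))) y
    formula-span with split (encForm (formula I)) (span-suffix [] w refl)
    ... | y , s , _ = y , subst (λ ls → Span 1 ls y) (sym (encTree-toTree (formula I))) s

    result : Bool
    result = valueOf (env encodes) (toTree (formula I))

    initial : Rep (replicate width emptyCell) (Vec.replicate 8 0) []
    initial = record
      { cells  = length-replicate width
      ; values = λ r → trans (zeros width r) (zero-reg r)
      ; rest   = _
      ; stacks = refl
      }
      where
      zero-bit : ∀ r → lookup (Vec.replicate 8 false) r ≡ false
      zero-bit r = lookup-replicate r false
      zero-reg : ∀ r → 0 ≡ lookup (Vec.replicate 8 0) r
      zero-reg r = sym (lookup-replicate r 0)
      zeros : ∀ n r → value (track r (replicate n emptyCell)) ≡ 0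
      zeros zero    r = refl
      zeros (suc n) r rewrite zero-bit r | zeros n r = refl

    program-result : ∃₂ λ cs i → Exec w program (replicate width emptyCell) (suc (length w)) result cs i
    program-result with perform (program-correct encodes (toTree (formula I)) (proj₂ formula-span)) initial
    ... | cs , _ , ex = cs , 0 , ex

    env-correct : ∀ u → (env encodes u ≡ true) ⇔ (u ∈ η K a)
    env-correct u = subst (λ ys → (env encodes u ≡ true) ⇔ (u ∈ ys))
      (trans (lookup-map a (η K) (allFin (size K))) (cong (η K) (lookup-allFin a)))
      (labelled⇔∈ u (lookup labels a))

    correct : (result ≡ true) ⇔ MCYes B I
    correct = Semantic.value⇔MCYes K a (env encodes) env-correct (formula I)

theorem12 : (B : List BoolFun) → InL (encInstance {B}) (MCYes B)
theorem12 B = inL {enc = encInstance {B}} {Q = MCYes B} Cell finite-Cell emptyCell program λ I width large →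
  let open Deciding I width large in result , program-result , correct
  where open ModelChecking B
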